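{- The algorithm WFAST solves the $(W,\epsilon,M)$-Volume Estimation problem: after processing any $(\mathcal U,M)$-weighted stream, for every $x\in\mathcal U$, the value $\widehat{v^W_x}$ returned by WinQuery$(x)$ satisfies $$v^W_x\le\widehat{v^W_x}\le v^W_x+W\cdot M\cdot\epsilon .$$
   Context: Streams. Given a set $\mathcal U$ (the universe of ids) and a positive integer $M$, a $(\mathcal U,M)$-weighted stream of length $N$ is a sequence $\langle p_1,\dots,p_N\rangle$ with $p_i=(d_i,w_i)\in\mathcal U\times\{1,\dots,M\}$ (id and weight). For a positive integer window size $W$, the window volume of $x$ is $v^W_x=\sum_{i\in\{N-W+1,\dots,N\},\,d_i=x}w_i$, the total weight of packets with id $x$ among the last $W$ packets. Algorithm FAST$(M,\delta,\phi)$ (with $\delta>0$, $\phi\ge 0$). Let $s=\lfloor M\phi/2+1\rfloor$ and $\mathfrak C=\lceil (1+\phi)/\delta\rceil$. State: a set $C\subseteq\mathcal U$ and non-negative integers $c_x,r_x$ for $x\in\mathcal U$; initially $C=\emptyset$, $c_x=r_x=0$. Add$(x,w)$: if $x\in C$ or $|C|<\mathfrak C$, set $c_x\gets c_x+\lfloor (r_x+w)/s\rfloor$, $r_x\gets (r_x+w)\bmod s$ (both using the old $r_x$), $C\gets C\cup\{x\}$; otherwise choose an arbitrary $m\in\arg\min_{y\in C}c_y$, set $c_x\gets c_m+\lfloor (s-1+w)/s\rfloor$, $r_x\gets (s-1+w)\bmod s$, $C\gets (C\setminus\{m\})\cup\{x\}$. Query$(x)$: if $x\in C$ or $|C|<\mathfrak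 C$, return $r_x+s c_x$; otherwise return $s-1+s\min_{y\in C}c_y$. A flush resets the instance to its initial state. Algorithm WFAST, with window size $W$, maximal weight $M$, accuracy $\epsilon>0$ and parameter $\phi$. Let $k=\lceil 4/\epsilon\rceil$; it is assumed that $W/k$ is an integer. The stream is partitioned into frames of $W$ packets, each split into $k$ blocks of $W/k$ packets. State: a FAST instance $y=$ FAST$(M,1/k,\phi)$; an offset $o$, initially $0$; a (FIFO) queue $b$ of $k+1$ (FIFO) queues of ids, initially all empty, whose head is the queue of the current (newest) block and whose tail is the queue of the oldest block; and a table $B$ of integer counts indexed by ids, initially empty. Add$(x,w)$: 1. $o\gets (o+1)\bmod W$. 2. If $o=0$ (new frame), flush $y$. 3. If $o\bmod (W/k)=0$ (new block), remove the oldest (tail) queue from $b$ and append a new empty queue as the head. 4. If the tail queue of $b$ is not empty, pop its oldest id $z$, decrease $B[z]$ by $1$, and remove $z$ from $B$ if $B[z]=0$. 5. Let $\pi=\left\lfloor \frac{y.\mathrm{Query}(x)}{MW/k}\right\rfloor$, then call $y.\mathrm{Add}(x,w)$. 6. If now $\left\lfloor \frac{y.\mathrm{Query}(x)}{MW/k}\right\rfloor>\pi$ ($x$ overflows), push $x$ onto the head queue of $b$, and increase $B[x]$ by $1$ (setting $B[x]=1$ if $x$ was not in $B$). WinQuery$(x)$: if $x$ is in $B$, return $\frac{MW}{k}(B[x]+2)+\left(y.\mathrm{Query}(x)\bmod \frac{MW}{k}\right)$; otherwise return $2\frac{MW}{k}+y.\mathrm{Query}(x)$. Processing the stream means calling Add$(d_i,w_i)$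 for $i=1,\dots,N$ in order. -}

module Defs where

open import Algebra.Bundles using (CommutativeRing)
import Algebra.Definitions.RawMonoid
import Algebra.Properties.Ring
open import Data.Bool.Base using (if_then_else_)
open import Data.Integer.Base as ℤ using (ℤ; +_; -[1+_]; ∣_∣)
import Data.Integer.Properties as ℤₚ
open import Data.List.Base as List using (List; []; _∷_; _∷ʳ_; length; drop; filter)
open import Data.List.Extrema.Nat using (argmin; min; argmin-sel; f[argmin]≤f[⊤]; f[argmin]≤f[xs])
import Data.List.Membership.DecPropositional
open import Data.List.Membership.Propositional using (_∈_)
open import Data.List.Relation.Unary.All using (All; _∷_)
open import Data.List.Relation.Unary.Any using (here; there)
open import Data.Maybe.Base using (Maybe; just; nothing)
open import Data.Nat.Base as ℕ using (ℕ; zero; suc; NonZero; ≢-nonZero; >-nonZero; >-nonZero⁻¹)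
open import Data.Nat.Divisibility using (_∣_; ∣⇒≤; ∣n⇒∣m*n)
open import Data.Nat.DivMod using (m≥n⇒m/n>0)
import Data.Nat.ListAction as ℕ using (sum)
import Data.Nat.Properties as ℕₚ
open import Data.Product.Base using (_×_; _,_; ∃)
open import Data.Sum.Base using (_⊎_; inj₁; inj₂; [_,_]′)
open import Data.Vec.Base as Vec using (Vec; []; _∷_)
open import Function.Base using (id)
open import Level using (_⊔_) renaming (suc to lsuc)
open import Relation.Binary.Core using (Rel)
open import Relation.Binary.Definitions using (DecidableEquality)
open import Relation.Binary.PropositionalEquality.Core using (subst) renaming (sym to ≡-sym; trans to ≡-trans)
open import Relation.Binary.Structures using (IsTotalOrder)
open import Relation.Nullary.Decidable.Core using (Dec; does; yes; no; _⊎-dec_; ¬?)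
open import Relation.Nullary.Negation.Core using (¬_; contradiction)

record OrderedField a ℓ₁ ℓ₂ : Set (lsuc (a ⊔ ℓ₁ ⊔ ℓ₂)) where
  infix  8 _⁻¹
  infixl 7 _/_
  infix  4 _≤_ _<_
  field
    commutativeRing : CommutativeRing a ℓ₁

  open CommutativeRing commutativeRing public

  field
    _≤_          : Rel Carrier ℓ₂
    isTotalOrder : IsTotalOrder _≈_ _≤_
    +-monoˡ-≤    : ∀ {x y} z → x ≤ y → x + z ≤ y + z
    *-nonNeg     : ∀ {x y} → 0# ≤ x → 0# ≤ y → 0# ≤ x * y
    1≉0          : ¬ (1# ≈ 0#)
    -- The value of 0# ⁻¹ is unspecified; it is never used.
    _⁻¹          : Carrier → Carrier
    *-inverseʳ   : ∀ x → ¬ (x ≈ 0#) → x * x ⁻¹ ≈ 1#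

  module ≤ = IsTotalOrder isTotalOrder

  _<_ : Rel Carrier (ℓ₁ ⊔ ℓ₂)
  x < y = x ≤ y × ¬ (x ≈ y)

  _/_ : Carrier → Carrier → Carrier
  x / y = x * y ⁻¹

  fromℕ : ℕ → Carrier
  fromℕ n = n · 1#
    where open Algebra.Definitions.RawMonoid +-rawMonoid using () renaming (_×_ to _·_)

  fromℤ : ℤ → Carrier
  fromℤ (+ n)      = fromℕ n
  fromℤ (-[1+ n ]) = - fromℕ (suc n)

-- The real parameters ε, δ, φ are taken from an arbitrary ordered field with a
-- floor function.  ℝ, with classical logic, is an instance; so is ℚ.
record FloorField a ℓ₁ ℓ₂ : Set (lsuc (a ⊔ ℓ₁ ⊔ ℓ₂)) where
  field
    orderedField : OrderedField a ℓ₁ ℓ₂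

  open OrderedField orderedField public

  field
    ⌊_⌋     : Carrier → ℤ
    ⌊x⌋≤x   : ∀ x → fromℤ ⌊ x ⌋ ≤ x
    x<⌊x⌋+1 : ∀ x → x < fromℤ ⌊ x ⌋ + 1#

  ⌈_⌉ : Carrier → ℤ
  ⌈ x ⌉ = ℤ.- ⌊ - x ⌋

module FloorFieldProperties {a ℓ₁ ℓ₂} (F : FloorField a ℓ₁ ℓ₂) where
  open FloorField F
  open Algebra.Properties.Ring ring using (-‿distribʳ-*; -‿involutive; -0#≈0#)

  private
    neg : ∀ {x} → x ≤ 0# → 0# ≤ - x
    neg {x} x≤0 = ≤.≤-respˡ-≈ (-‿inverseʳ x)
      (≤.≤-respʳ-≈ (+-identityˡ (- x)) (+-monoˡ-≤ (- x) x≤0))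

    neg′ : ∀ {x} → 0# ≤ - x → x ≤ 0#
    neg′ {x} p = ≤.≤-respˡ-≈ (+-identityˡ x)
      (≤.≤-respʳ-≈ (-‿inverseˡ x) (+-monoˡ-≤ x p))

    0≤1 : 0# ≤ 1#
    0≤1 = [ id , (λ 1≤0 → ≤.≤-respʳ-≈ -1*-1≈1 (*-nonNeg (neg 1≤0) (neg 1≤0))) ]′ (≤.total 0# 1#)
      where
      -1*-1≈1 : - 1# * - 1# ≈ 1#
      -1*-1≈1 = trans (sym (-‿distribʳ-* (- 1#) 1#))
        (trans (-‿cong (*-identityʳ (- 1#))) (-‿involutive 1#))

    +-nonNeg : ∀ {x y} → 0# ≤ x → 0# ≤ y → 0# ≤ x + y
    +-nonNeg {x} {y} p q = ≤.trans q (≤.≤-respˡ-≈ (+-identityˡ y) (+-monoˡ-≤ y p))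

    fromℕ-nonNeg : ∀ n → 0# ≤ fromℕ n
    fromℕ-nonNeg zero    = ≤.refl
    fromℕ-nonNeg (suc n) = +-nonNeg 0≤1 (fromℕ-nonNeg n)

    1+-pos : ∀ {x} → 0# ≤ x → 0# < 1# + x
    1+-pos {x} 0≤x = +-nonNeg 0≤1 0≤x , λ 0≈1+x → 1≉0 (≤.antisym
      (≤.≤-respʳ-≈ (sym 0≈1+x) (≤.≤-respʳ-≈ (+-comm x 1#) (≤.≤-respˡ-≈ (+-identityˡ 1#) (+-monoˡ-≤ 1# 0≤x))))
      0≤1)

    ⁻¹-nonNeg : ∀ {x} → 0# < x → 0# ≤ x ⁻¹
    ⁻¹-nonNeg {x} (0≤x , 0≉x) with ≤.total 0# (x ⁻¹)
    ... | inj₁ p = p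
    ... | inj₂ p = contradiction (≤.antisym (neg′ 0≤-1) 0≤1) 1≉0
      where
      0≤-1 : 0# ≤ - 1#
      0≤-1 = ≤.≤-respʳ-≈
        (trans (sym (-‿distribʳ-* x (x ⁻¹))) (-‿cong (*-inverseʳ x (λ x≈0 → 0≉x (sym x≈0)))))
        (*-nonNeg 0≤x (neg p))

    ⁻¹-pos : ∀ {x} → 0# < x → 0# < x ⁻¹
    ⁻¹-pos {x} 0<x@(_ , 0≉x) = ⁻¹-nonNeg 0<x , λ 0≈x⁻¹ → 1≉0
      (trans (sym (*-inverseʳ x (λ x≈0 → 0≉x (sym x≈0))))
        (trans (*-congˡ (sym 0≈x⁻¹)) (zeroʳ x)))

  fromℕ-pos : ∀ n .{{_ : NonZero n}} → 0# < fromℕ n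
  fromℕ-pos (suc n) = 1+-pos (fromℕ-nonNeg n)

  1/-pos : ∀ {x} → 0# < x → 0# < 1# / x
  1/-pos {x} 0<x with ⁻¹-pos 0<x
  ... | p , q = ≤.≤-respʳ-≈ (sym (*-identityˡ (x ⁻¹))) p , λ e → q (trans e (*-identityˡ (x ⁻¹)))

  /-pos : ∀ {x y} → 0# < x → 0# < y → 0# < x / y
  /-pos {x} {y} (0≤x , 0≉x) 0<y@(_ , 0≉y) = *-nonNeg 0≤x (⁻¹-nonNeg 0<y) , λ e → 0≉x
    (trans (sym (zeroˡ y)) (trans (*-congʳ e)
      (trans (*-assoc x (y ⁻¹) y)
        (trans (*-congˡ (trans (*-comm (y ⁻¹) y) (*-inverseʳ y (λ y≈0 → 0≉y (sym y≈0)))))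
          (*-identityʳ x)))))

  1+x-pos : ∀ {x} → 0# ≤ x → 0# < 1# + x
  1+x-pos = 1+-pos

  *-/-nonNeg : ∀ m n .{{_ : NonZero n}} {φ} → 0# ≤ φ → 0# ≤ fromℕ m * φ / fromℕ n
  *-/-nonNeg m n 0≤φ = *-nonNeg (*-nonNeg (fromℕ-nonNeg m) 0≤φ) (⁻¹-nonNeg (fromℕ-pos n))

  ⌈⌉-nonZero : ∀ {x} → 0# < x → NonZero ∣ ⌈ x ⌉ ∣
  ⌈⌉-nonZero {x} (0≤x , 0≉x) = ≢-nonZero λ e → 0≉x (≤.antisym 0≤x (neg′
    (subst (λ z → fromℤ z ≤ - x)
      (ℤₚ.∣i∣≡0⇒i≡0 {⌊ - x ⌋} (≡-trans (≡-sym (ℤₚ.∣-i∣≡∣i∣ ⌊ - x ⌋)) e))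
      (⌊x⌋≤x (- x)))))

  ⌊+1⌋-nonZero : ∀ {x} → 0# ≤ x → NonZero ∣ ⌊ x + 1# ⌋ ∣
  ⌊+1⌋-nonZero {x} 0≤x = ≢-nonZero λ e → contra
    (subst (λ z → x + 1# < fromℤ z + 1#) (ℤₚ.∣i∣≡0⇒i≡0 {⌊ x + 1# ⌋} e) (x<⌊x⌋+1 (x + 1#)))
    where
    contra : ¬ (x + 1# < 0# + 1#)
    contra (p , q) = q (≤.antisym p (+-monoˡ-≤ 1# 0≤x))

module FAST {a ℓ₁ ℓ₂ u} (F : FloorField a ℓ₁ ℓ₂) {U : Set u} (_≟_ : DecidableEquality U)
            (M : ℕ) (δ φ : FloorField.Carrier F)
            (0<δ : FloorField._<_ F (FloorField.0# F) δ)
            (0≤φ : FloorField._≤_ F (FloorField.0# F) φ) where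
  open FloorField F using (1#; _+_; _*_; _/_; fromℕ; ⌊_⌋; ⌈_⌉)
  open FloorFieldProperties F
  open Data.List.Membership.DecPropositional _≟_ using (_∈?_)

  -- Both integers are positive, so ∣_∣ loses nothing.
  s : ℕ
  s = ∣ ⌊ fromℕ M * φ / fromℕ 2 + 1# ⌋ ∣

  ℭ : ℕ
  ℭ = ∣ ⌈ (1# + φ) / δ ⌉ ∣

  instance
    s-nonZero : NonZero s
    s-nonZero = ⌊+1⌋-nonZero (*-/-nonNeg M 2 0≤φ)

    ℭ-nonZero : NonZero ℭ
    ℭ-nonZero = ⌈⌉-nonZero (/-pos (1+x-pos 0≤φ) 0<δ)

  -- The finite set C is a list to which only absent elements are added.
  record State : Set u where
    field
      C   : List U
      c r : U → ℕ

  open State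

  initial : State
  initial = record { C = [] ; c = λ _ → 0 ; r = λ _ → 0 }

  _[_↦_] : (U → ℕ) → U → ℕ → (U → ℕ)
  (f [ x ↦ n ]) y = if does (y ≟ x) then n else f y

  insert : U → List U → List U
  insert x xs = if does (x ∈? xs) then xs else x ∷ xs

  remove : U → List U → List U
  remove m = filter (λ y → ¬? (y ≟ m))

  Direct : State → U → Set u
  Direct S x = x ∈ C S ⊎ length (C S) ℕ.< ℭ

  direct? : ∀ S x → Dec (Direct S x)
  direct? S x = (x ∈? C S) ⊎-dec (length (C S) ℕₚ.<? ℭ)

  -- The minimum of f over a list; only used on non-empty lists (ℭ is positive).
  minimum : (U → ℕ) → List U → ℕ
  minimum f []       = 0
  minimum f (y ∷ ys) = min (f y) (List.map f ys)

  query : State → U → ℕ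
  query S x = if does (direct? S x)
    then r S x ℕ.+ s ℕ.* c S x
    else (s ℕ.∸ 1) ℕ.+ s ℕ.* minimum (c S) (C S)

  addDirect : State → U → ℕ → State
  addDirect S x w = record
    { C = insert x (C S)
    ; c = c S [ x ↦ c S x ℕ.+ (r S x ℕ.+ w) ℕ./ s ]
    ; r = r S [ x ↦ (r S x ℕ.+ w) ℕ.% s ]
    }

  addReplacing : U → State → U → ℕ → State
  addReplacing m S x w = record
    { C = insert x (remove m (C S))
    ; c = c S [ x ↦ c S m ℕ.+ ((s ℕ.∸ 1) ℕ.+ w) ℕ./ s ]
    ; r = r S [ x ↦ ((s ℕ.∸ 1) ℕ.+ w) ℕ.% s ]
    }

  -- A relation, since the choice of m in the arg min is arbitrary at each call.
  data Add (S : State) (x : U) (w : ℕ) : State → Set u where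
    direct  : Direct S x → Add S x w (addDirect S x w)
    replace : ¬ Direct S x →
              ∀ m → m ∈ C S → All (λ y → c S m ℕ.≤ c S y) (C S) →
              Add S x w (addReplacing m S x w)

  argmin-exists : ∀ (f : U → ℕ) xs → 0 ℕ.< length xs → ∃ λ m → m ∈ xs × All (λ y → f m ℕ.≤ f y) xs
  argmin-exists f (y ∷ ys) _ = argmin f y ys
    , [ here , there ]′ (argmin-sel f y ys)
    , f[argmin]≤f[⊤] {f = f} y ys ∷ f[argmin]≤f[xs] y ys

  add-total : ∀ S x w → ∃ (Add S x w)
  add-total S x w with direct? S x
  ... | yes d = addDirect S x w , direct d
  ... | no ¬d =
    let m , m∈C , m-min = argmin-exists (c S) (C S)
          (ℕₚ.<-≤-trans (>-nonZero⁻¹ ℭ) (ℕₚ.≮⇒≥ (λ <ℭ → ¬d (inj₂ <ℭ))))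
    in  addReplacing m S x w , replace ¬d m m∈C m-min

numBlocks : ∀ {a ℓ₁ ℓ₂} (F : FloorField a ℓ₁ ℓ₂) → FloorField.Carrier F → ℕ
numBlocks F ε = ∣ ⌈ fromℕ 4 / ε ⌉ ∣
  where open FloorField F

record Packet {u} (U : Set u) (M : ℕ) : Set u where
  field
    ident    : U
    weight   : ℕ
    1≤weight : 1 ℕ.≤ weight
    weight≤M : weight ℕ.≤ M

Stream : ∀ {u} → Set u → ℕ → Set u
Stream U M = List (Packet U M)

-- While fewer than W packets have arrived, the window is the whole stream.
windowVolume : ∀ {u} {U : Set u} {M} → DecidableEquality U → ℕ → Stream U M → U → ℕ
windowVolume _≟_ W ps x =
  ℕ.sum (List.map weight (filter (λ p → ident p ≟ x) (drop (length ps ℕ.∸ W) ps)))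
  where open Packet

module WFAST {a ℓ₁ ℓ₂ u} (F : FloorField a ℓ₁ ℓ₂) {U : Set u} (_≟_ : DecidableEquality U)
             (W M : ℕ) .{{_ : NonZero W}} .{{_ : NonZero M}}
             (ε φ : FloorField.Carrier F)
             (0<ε : FloorField._<_ F (FloorField.0# F) ε)
             (0≤φ : FloorField._≤_ F (FloorField.0# F) φ)
             (k∣W : numBlocks F ε ∣ W) where
  open FloorField F using (1#; _/_; fromℕ)
  open FloorFieldProperties F

  k : ℕ
  k = numBlocks F ε

  instance
    k-nonZero : NonZero k
    k-nonZero = ⌈⌉-nonZero (/-pos (fromℕ-pos 4) 0<ε)

  blockSize : ℕ
  blockSize = W ℕ./ k

  -- MW/k, an exact quotient because k divides W.
  T : ℕ
  T = (M ℕ.* W) ℕ./ k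

  instance
    blockSize-nonZero : NonZero blockSize
    blockSize-nonZero = >-nonZero (m≥n⇒m/n>0 (∣⇒≤ k∣W))

    T-nonZero : NonZero T
    T-nonZero = >-nonZero (m≥n⇒m/n>0 (∣⇒≤ {{ℕₚ.m*n≢0 M W}} (∣n⇒∣m*n M k∣W)))

  module Y = FAST F _≟_ M (1# / fromℕ k) φ (1/-pos (fromℕ-pos k)) 0≤φ

  -- The oldest id of an inner queue is the first of its list.  In the outer queue
  -- the block queues are ordered from the newest (first) to the oldest (last).
  Queues : Set u
  Queues = Vec (List U) (suc k)

  Table : Set u
  Table = U → Maybe ℕ

  record State : Set u where
    field
      y : Y.State
      o : ℕ
      b : Queues
      B : Table

  open State

  initial : State
  initial = record { y = Y.initial ; o = 0 ; b = Vec.replicate (suc k) [] ; B = λ _ → nothing }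

  _[_↦_] : Table → U → Maybe ℕ → Table
  (f [ x ↦ v ]) z = if does (z ≟ x) then v else f z

  incr : Maybe ℕ → Maybe ℕ
  incr nothing  = just 1
  incr (just n) = just (suc n)

  -- The first two cases do not arise: every queued id has a positive count.
  decr : Maybe ℕ → Maybe ℕ
  decr nothing              = nothing
  decr (just 0)             = nothing
  decr (just 1)             = nothing
  decr (just (suc (suc n))) = just (suc n)

  nextOffset : ℕ → ℕ
  nextOffset o = (o ℕ.+ 1) ℕ.% W

  newFrame : ℕ → Y.State → Y.State
  newFrame o y = if does (o ℕₚ.≟ 0) then Y.initial else y

  newBlock : ℕ → Queues → Queues
  newBlock o b = if does (o ℕ.% blockSize ℕₚ.≟ 0) then [] ∷ Vec.init b else b

  expire : Queues → Table → Queues × Table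
  expire b B with Vec.last b
  ... | []     = b , B
  ... | z ∷ zs = Vec.init b Vec.∷ʳ zs , B [ z ↦ decr (B z) ]

  -- Everything in an addition that precedes the use of the FAST instance.
  prepare : State → State
  prepare S =
    let o′      = nextOffset (o S)
        b′ , B′ = expire (newBlock o′ (b S)) (B S)
    in  record { y = newFrame o′ (y S) ; o = o′ ; b = b′ ; B = B′ }

  overflow : U → State → State
  overflow x S = record S
    { b = (Vec.head (b S) ∷ʳ x) ∷ Vec.tail (b S)
    ; B = B S [ x ↦ incr (B S x) ]
    }

  update : State → U → Y.State → State
  update S x y′ =
    if does (Y.query (y S) x ℕ./ T ℕₚ.<? Y.query y′ x ℕ./ T)
    then overflow x (record S { y = y′ })
    else record S { y = y′ }

  data Add (S : State) (x : U) (w : ℕ) : State → Set u where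
    add : ∀ {y′} → Y.Add (y (prepare S)) x w y′ → Add S x w (update (prepare S) x y′)

  data Process (S : State) : Stream U M → State → Set u where
    []  : Process S [] S
    _∷_ : ∀ {p ps S′ S″} → Add S (Packet.ident p) (Packet.weight p) S′ →
          Process S′ ps S″ → Process S (p ∷ ps) S″

  process-total : ∀ S ps → ∃ (Process S ps)
  process-total S []       = S , []
  process-total S (p ∷ ps) =
    let y′ , a = Y.add-total (y (prepare S)) (Packet.ident p) (Packet.weight p)
        S″ , q = process-total (update (prepare S) (Packet.ident p) y′) ps
    in  S″ , add a ∷ q

  winQuery : State → U → ℕ
  winQuery S x with B S x
  ... | just n  = T ℕ.* (n ℕ.+ 2) ℕ.+ Y.query (y S) x ℕ.% T
  ... | nothing = 2 ℕ.* T ℕ.+ Y.query (y S) x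

{-# OPTIONS --safe #-}
module Submission where

-- Within a frame, adding x raises FAST's estimate q of x by exactly the added weight.
-- Otherwise q changes only by a "silent rise" to s − 1 + s · min c, when the table is full;
-- after n packets this is at most Mn/k, hence below T = MW/k until the frame is complete.
-- So silent rises cross no multiple of T before the last packet of the frame, the overflows
-- of x in the current frame number ⌊q/T⌋, and WinQuery returns 2T + q + Tn₂, where n₂ counts
-- the queued overflows that come from the previous frame.  Here q exceeds the volume of x in
-- the current frame by at most T.  The queues hold all overflows of the current and the last
-- k − 1 complete blocks, and none older than the window; since q is at most T after its last
-- silent rise in a frame, v₂ − 2T ≤ Tn₂ ≤ v₂ + T for the volume v₂ of x in the part of the
-- window lying in the previous frame.  The error is thus between 0 and 4T ≤ WMε.

open import Defs
open import Algebra.Properties.Semiring.Mult using (×1-homo-*)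
import Algebra.Properties.Monoid.Mult as Mult
import Algebra.Properties.Ring
open import Data.Integer.Base as ℤ using (∣_∣)
import Data.Integer.Properties as ℤₚ
open import Data.Nat.Base as ℕ using (ℕ; zero; suc; NonZero)
open import Data.Nat.Divisibility using (_∣_; divides; ∣-refl; ∣n⇒∣m*n)
open import Data.Nat.DivMod using (m/n*n≡m)
import Data.Nat.Properties as ℕₚ
open import Data.Product.Base using (_×_; _,_; proj₁; proj₂; ∃)
open import Level using (Level)
open import Relation.Binary.Bundles using (Poset)
open import Relation.Binary.Definitions using (DecidableEquality)
import Relation.Binary.PropositionalEquality as ≡
open import Relation.Nullary.Negation using (¬_; contradiction)

-- The bound `M n / k` on silent rises fixes the size of the table. FAST can overestimate by `s ∸ 1`
-- in two places: a replacement discards the remainder of the evicted id, and the query of an absent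
-- id rounds up. Both together cost at most `M φ`, since `s ∸ 1` is at most `M φ / 2`; the factor
-- `1 + φ` in `ℭ` pays for them. The delicate point is that a silent rise records no overflow. On
-- the last packet of a frame it may bring the estimate to `T` exactly while the queues contain no
-- entry for the id. At that moment the window is the current frame, so the table has no entry at
-- all, and WinQuery uses the whole estimate instead of its residue modulo `T`. The minimiser that
-- FAST evicts is arbitrary, so no particular run can be followed. The proof fixes one id `x` and
-- keeps a history of packets, overflow flags and estimates of `x`; FAST enters it only through the
-- few ways in which one packet can move that estimate.

module OrderedFieldProperties {a ℓ₁ ℓ₂} (F : FloorField a ℓ₁ ℓ₂) where
  open FloorField F
  open FloorFieldProperties F
  open Algebra.Properties.Ring ring using (-‿involutive; -0#≈0#)

  -- Arithmetic in ordered fields, floors and ceilings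

  poset : Poset a ℓ₁ ℓ₂
  poset = record { isPartialOrder = ≤.isPartialOrder }
  open import Relation.Binary.Reasoning.PartialOrder poset

  +-monoʳ-≤ : ∀ z {x y} → x ≤ y → z + x ≤ z + y
  +-monoʳ-≤ z {x} {y} x≤y = begin
    z + x ≈⟨ +-comm z x ⟩
    x + z ≤⟨ +-monoˡ-≤ z x≤y ⟩
    y + z ≈⟨ +-comm y z ⟩
    z + y ∎

  +-cancelʳ-≤ : ∀ z {x y} → x + z ≤ y + z → x ≤ y
  +-cancelʳ-≤ z {x} {y} p = begin
    x             ≈⟨ cancel x ⟨
    (x + z) + - z ≤⟨ +-monoˡ-≤ (- z) p ⟩
    (y + z) + - z ≈⟨ cancel y ⟩
    y             ∎
    where
    cancel : ∀ x → (x + z) + - z ≈ x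
    cancel x = trans (+-assoc x z (- z)) (trans (+-congˡ (-‿inverseʳ z)) (+-identityʳ x))

  x≤y⇒0≤y-x : ∀ {x y} → x ≤ y → 0# ≤ y + - x
  x≤y⇒0≤y-x {x} {y} x≤y = begin
    0#      ≈⟨ -‿inverseʳ x ⟨
    x + - x ≤⟨ +-monoˡ-≤ (- x) x≤y ⟩
    y + - x ∎

  neg-mono-≤ : ∀ {x y} → x ≤ y → - y ≤ - x
  neg-mono-≤ {x} {y} x≤y = +-cancelʳ-≤ y (begin
    - y + y ≈⟨ -‿inverseˡ y ⟩
    0#      ≤⟨ x≤y⇒0≤y-x x≤y ⟩
    y + - x ≈⟨ +-comm y (- x) ⟩
    - x + y ∎)

  *-monoʳ-≤ : ∀ {z} → 0# ≤ z → ∀ {x y} → x ≤ y → x * z ≤ y * z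
  *-monoʳ-≤ {z} 0≤z {x} {y} x≤y = begin
    x * z                   ≈⟨ +-identityˡ (x * z) ⟨
    0# + x * z              ≤⟨ +-monoˡ-≤ (x * z) (*-nonNeg (x≤y⇒0≤y-x x≤y) 0≤z) ⟩
    (y + - x) * z + x * z   ≈⟨ distribʳ z (y + - x) x ⟨
    ((y + - x) + x) * z     ≈⟨ *-congʳ (trans (+-assoc y (- x) x) (trans (+-congˡ (-‿inverseˡ x)) (+-identityʳ y))) ⟩
    y * z                   ∎

  x/y≤z⇒x≤z*y : ∀ {x y z} → 0# < y → x / y ≤ z → x ≤ z * y
  x/y≤z⇒x≤z*y {x} {y} {z} (0≤y , 0≉y) p = begin
    x              ≈⟨ *-identityʳ x ⟨
    x * 1#         ≈⟨ *-congˡ (trans (*-comm _ y) (*-inverseʳ y (λ y≈0 → 0≉y (sym y≈0)))) ⟨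
    x * (y ⁻¹ * y) ≈⟨ *-assoc x (y ⁻¹) y ⟨
    x / y * y      ≤⟨ *-monoʳ-≤ 0≤y p ⟩
    z * y          ∎

  x≤z*1/y⇒x*y≤z : ∀ {x y z} → 0# < y → x ≤ z * (1# / y) → x * y ≤ z
  x≤z*1/y⇒x*y≤z {x} {y} {z} (0≤y , 0≉y) p = begin
    x * y              ≤⟨ *-monoʳ-≤ 0≤y p ⟩
    z * (1# / y) * y   ≈⟨ *-congʳ (*-congˡ (*-identityˡ (y ⁻¹))) ⟩
    z * y ⁻¹ * y       ≈⟨ *-assoc z (y ⁻¹) y ⟩
    z * (y ⁻¹ * y)     ≈⟨ *-congˡ (trans (*-comm _ y) (*-inverseʳ y (λ y≈0 → 0≉y (sym y≈0)))) ⟩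
    z * 1#             ≈⟨ *-identityʳ z ⟩
    z                  ∎

  fromℕ-nonNeg : ∀ n → 0# ≤ fromℕ n
  fromℕ-nonNeg zero    = ≤.refl
  fromℕ-nonNeg (suc n) = proj₁ (fromℕ-pos (suc n))

  fromℕ-+ : ∀ m n → fromℕ (m ℕ.+ n) ≈ fromℕ m + fromℕ n
  fromℕ-+ = Mult.×-homo-+ +-monoid 1#

  fromℕ-* : ∀ m n → fromℕ (m ℕ.* n) ≈ fromℕ m * fromℕ n
  fromℕ-* = ×1-homo-* semiring

  fromℕ-mono-≤ : ∀ {m n} → m ℕ.≤ n → fromℕ m ≤ fromℕ n
  fromℕ-mono-≤ {n = n} ℕ.z≤n = fromℕ-nonNeg n
  fromℕ-mono-≤ (ℕ.s≤s m≤n)   = +-monoʳ-≤ 1# (fromℕ-mono-≤ m≤n)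

  -- Lets `FAST-capacity` be derived in the field, where `φ` lives, and then be used in ℕ.
  fromℕ-cancel-≤ : ∀ m n → fromℕ m ≤ fromℕ n → m ℕ.≤ n
  fromℕ-cancel-≤ zero    n       _ = ℕ.z≤n
  fromℕ-cancel-≤ (suc m) zero    p = contradiction (≤.antisym (proj₁ (fromℕ-pos (suc m))) p) (proj₂ (fromℕ-pos (suc m)))
  fromℕ-cancel-≤ (suc m) (suc n) p = ℕ.s≤s (fromℕ-cancel-≤ m n (+-cancelʳ-≤ 1#
    (≤.≤-respˡ-≈ (+-comm 1# _) (≤.≤-respʳ-≈ (+-comm 1# _) p))))

  -fromℤ≤∣∣ : ∀ i → - fromℤ i ≤ fromℕ ∣ i ∣
  -fromℤ≤∣∣ (ℤ.+ n)      = begin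
    - fromℕ n ≤⟨ neg-mono-≤ (fromℕ-nonNeg n) ⟩
    - 0#      ≈⟨ -0#≈0# ⟩
    0#        ≤⟨ fromℕ-nonNeg n ⟩
    fromℕ n   ∎
  -fromℤ≤∣∣ (ℤ.-[1+ n ]) = ≤.reflexive (-‿involutive (fromℕ (suc n)))

  -- Passing from the ceiling to its absolute value can only increase it, so the upper bound
  -- survives whatever the sign.
  x≤∣⌈x⌉∣ : ∀ x → x ≤ fromℕ ∣ ⌈ x ⌉ ∣
  x≤∣⌈x⌉∣ x = begin
    x                     ≈⟨ -‿involutive x ⟨
    - (- x)               ≤⟨ neg-mono-≤ (⌊x⌋≤x (- x)) ⟩
    - fromℤ ⌊ - x ⌋       ≤⟨ -fromℤ≤∣∣ ⌊ - x ⌋ ⟩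
    fromℕ ∣ ⌊ - x ⌋ ∣     ≡⟨ ≡.cong fromℕ (ℤₚ.∣-i∣≡∣i∣ ⌊ - x ⌋) ⟨
    fromℕ ∣ ⌈ x ⌉ ∣       ∎

  -- Here the absolute value could do harm, so a negative floor has to be excluded: it would give
  -- `⌊ x ⌋ + 1 ≤ 0 ≤ x`, against `x < ⌊ x ⌋ + 1`.
  ∣⌊x⌋∣≤x : ∀ {x} → 0# ≤ x → fromℕ ∣ ⌊ x ⌋ ∣ ≤ x
  ∣⌊x⌋∣≤x {x} 0≤x = go ⌊ x ⌋ (⌊x⌋≤x x) (x<⌊x⌋+1 x)
    where
    go : ∀ i → fromℤ i ≤ x → x < fromℤ i + 1# → fromℕ ∣ i ∣ ≤ x
    go (ℤ.+ n)      p _ = p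
    go (ℤ.-[1+ n ]) _ (p , x≉) = contradiction (≤.antisym p (≤.trans i+1≤0 0≤x)) x≉
      where
      i+1≤0 : - fromℕ (suc n) + 1# ≤ 0#
      i+1≤0 = begin
        - (1# + fromℕ n) + 1#     ≤⟨ +-monoˡ-≤ 1# (neg-mono-≤ (≤.≤-respˡ-≈ (+-identityʳ 1#) (+-monoʳ-≤ 1# (fromℕ-nonNeg n)))) ⟩
        - 1# + 1#                 ≈⟨ -‿inverseˡ 1# ⟩
        0#                        ∎

  -- The 4 in `numBlocks` is the number of units `T` that the estimate can be off by.
  4≤k*ε : ∀ {ε} → 0# < ε → fromℕ 4 ≤ fromℕ (numBlocks F ε) * ε
  4≤k*ε 0<ε = x/y≤z⇒x≤z*y 0<ε (x≤∣⌈x⌉∣ _)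

  4*T≤W*M*ε : ∀ {ε} W M T → 0# < ε → T ℕ.* numBlocks F ε ≡.≡ W ℕ.* M → fromℕ (4 ℕ.* T) ≤ fromℕ W * fromℕ M * ε
  4*T≤W*M*ε {ε} W M T 0<ε Tk≡WM = begin
    fromℕ (4 ℕ.* T)                         ≈⟨ fromℕ-* 4 T ⟩
    fromℕ 4 * fromℕ T                       ≤⟨ *-monoʳ-≤ (fromℕ-nonNeg T) (4≤k*ε 0<ε) ⟩
    fromℕ (numBlocks F ε) * ε * fromℕ T     ≈⟨ trans (*-comm _ _) (sym (*-assoc _ _ _)) ⟩
    fromℕ T * fromℕ (numBlocks F ε) * ε     ≈⟨ *-congʳ (fromℕ-* T _) ⟨
    fromℕ (T ℕ.* numBlocks F ε) * ε         ≡⟨ ≡.cong (λ n → fromℕ n * ε) Tk≡WM ⟩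
    fromℕ (W ℕ.* M) * ε                     ≈⟨ *-congʳ (fromℕ-* W M) ⟩
    fromℕ W * fromℕ M * ε                   ∎

-- Capacity of the FAST instance

module _ {a ℓ₁ ℓ₂ u} (F : FloorField a ℓ₁ ℓ₂) {U : Set u} (_≟_ : DecidableEquality U)
         (M k : ℕ) .{{_ : NonZero k}} (φ : FloorField.Carrier F)
         (0≤φ : FloorField._≤_ F (FloorField.0# F) φ) where
  open FloorField F
  open FloorFieldProperties F
  open OrderedFieldProperties F
  open FAST F _≟_ M (1# / fromℕ k) φ (1/-pos (fromℕ-pos k)) 0≤φ using (s; ℭ)
  open import Relation.Binary.Reasoning.PartialOrder poset

  2*[s∸1]≤M*φ : fromℕ (2 ℕ.* (s ℕ.∸ 1)) ≤ fromℕ M * φ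
  2*[s∸1]≤M*φ = begin
    fromℕ (2 ℕ.* (s ℕ.∸ 1))         ≡⟨ ≡.cong fromℕ (ℕₚ.*-comm 2 (s ℕ.∸ 1)) ⟩
    fromℕ ((s ℕ.∸ 1) ℕ.* 2)         ≈⟨ fromℕ-* (s ℕ.∸ 1) 2 ⟩
    fromℕ (s ℕ.∸ 1) * fromℕ 2       ≤⟨ *-monoʳ-≤ (fromℕ-nonNeg 2) (pred-≤ s (∣⌊x⌋∣≤x 0≤half+1)) ⟩
    half * fromℕ 2                  ≈⟨ *-assoc (fromℕ M * φ) (fromℕ 2 ⁻¹) (fromℕ 2) ⟩
    fromℕ M * φ * (fromℕ 2 ⁻¹ * fromℕ 2) ≈⟨ *-congˡ (trans (*-comm _ _) (*-inverseʳ (fromℕ 2) (λ e → proj₂ (fromℕ-pos 2) (sym e)))) ⟩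
    fromℕ M * φ * 1#                ≈⟨ *-identityʳ (fromℕ M * φ) ⟩
    fromℕ M * φ                     ∎
    where
    half : Carrier
    half = fromℕ M * φ / fromℕ 2
    0≤half : 0# ≤ half
    0≤half = *-/-nonNeg M 2 0≤φ
    0≤half+1 : 0# ≤ half + 1#
    0≤half+1 = ≤.≤-respʳ-≈ (+-comm 1# half) (proj₁ (1+x-pos 0≤half))
    pred-≤ : ∀ n → fromℕ n ≤ half + 1# → fromℕ (n ℕ.∸ 1) ≤ half
    pred-≤ zero    _ = 0≤half
    pred-≤ (suc n) p = +-cancelʳ-≤ 1# (≤.≤-respˡ-≈ (+-comm 1# (fromℕ n)) p)

  [1+φ]*k≤ℭ : (1# + φ) * fromℕ k ≤ fromℕ ℭ
  [1+φ]*k≤ℭ = x≤z*1/y⇒x*y≤z (fromℕ-pos k) (x/y≤z⇒x≤z*y (1/-pos (fromℕ-pos k)) (x≤∣⌈x⌉∣ _))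

  -- Collects all that the choices of `s` and `ℭ` achieve, in a form free of `φ`. The summand `M`
  -- stands for the weight of a packet, and the two copies of `s ∸ 1` for the rounding on
  -- replacement and in the query of an absent id.
  FAST-capacity : k ℕ.* (M ℕ.+ 2 ℕ.* (s ℕ.∸ 1)) ℕ.≤ M ℕ.* ℭ
  FAST-capacity = fromℕ-cancel-≤ _ _ (begin
    fromℕ (k ℕ.* (M ℕ.+ 2 ℕ.* (s ℕ.∸ 1)))    ≈⟨ trans (fromℕ-* k _) (*-comm _ _) ⟩
    fromℕ (M ℕ.+ 2 ℕ.* (s ℕ.∸ 1)) * fromℕ k  ≈⟨ *-congʳ (fromℕ-+ M _) ⟩
    (fromℕ M + fromℕ (2 ℕ.* (s ℕ.∸ 1))) * fromℕ k ≤⟨ *-monoʳ-≤ (fromℕ-nonNeg k) (+-monoʳ-≤ (fromℕ M) 2*[s∸1]≤M*φ) ⟩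
    (fromℕ M + fromℕ M * φ) * fromℕ k        ≈⟨ *-congʳ (trans (distribˡ (fromℕ M) 1# φ) (+-congʳ (*-identityʳ (fromℕ M)))) ⟨
    fromℕ M * (1# + φ) * fromℕ k             ≈⟨ trans (*-assoc _ _ _) (*-comm _ _) ⟩
    (1# + φ) * fromℕ k * fromℕ M             ≤⟨ *-monoʳ-≤ (fromℕ-nonNeg M) [1+φ]*k≤ℭ ⟩
    fromℕ ℭ * fromℕ M                        ≈⟨ trans (*-comm _ _) (sym (fromℕ-* M ℭ)) ⟩
    fromℕ (M ℕ.* ℭ)                          ∎)

module Analysis where
  open import Data.Bool.Base using (Bool; true; false; if_then_else_)
  open import Data.List.Base using (List; []; _∷_; [_]; _++_; _∷ʳ_; _ʳ++_; length; map; filter; take; drop; reverse)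
  open import Data.List.Extrema.Nat using (v≤min⁺; min≤⊤; min≤xs)
  import Data.List.Membership.DecPropositional
  open import Data.List.Membership.Propositional using (_∈_; _∉_)
  open import Data.List.Membership.Propositional.Properties using (∈-filter⁺; ∈-filter⁻)
  open import Data.List.Properties hiding (sum-++)
  open import Data.List.Relation.Binary.Permutation.Propositional using (_↭_; prep; swap; ↭-refl; ↭-trans)
  open import Data.List.Relation.Binary.Permutation.Propositional.Properties using (map⁺; ↭-length)
  open import Data.List.Relation.Unary.All as All using (All; []; _∷_)
  import Data.List.Relation.Unary.All.Properties as All
  open import Data.List.Relation.Unary.Any using (here; there)
  open import Data.List.Relation.Unary.Unique.Propositional using (Unique; []; _∷_)
  import Data.List.Relation.Unary.Unique.Propositional.Properties as Unique
  open import Data.Maybe.Base using (Maybe; just; nothing)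
  open import Data.Nat.Base
  open import Data.Nat.DivMod
  open import Data.Nat.ListAction using (sum)
  open import Data.Nat.ListAction.Properties using (sum-++; sum-↭)
  open import Data.Nat.Properties hiding (_≟_)
  open import Data.Nat.Solver using (module +-*-Solver)
  open import Data.Sum.Base as Sum using (_⊎_; inj₁; inj₂; fromInj₁; fromInj₂)
  open import Data.Unit.Polymorphic.Base using (⊤; tt)
  open import Data.Vec.Base as Vec using (Vec; []; _∷_)
  open import Function.Base using (_∘_)
  open import Relation.Binary.PropositionalEquality using (_≡_; _≢_; refl; sym; trans; cong; cong₂; subst; subst₂; module ≡-Reasoning)
  open import Relation.Nullary.Decidable using (Dec; does; yes; no; ¬?; dec-true; dec-false)
  open +-*-Solver using (solve; _:+_; _:*_; _:=_; con)

  if-yes : ∀ {p a} {P : Set p} {A : Set a} (P? : Dec P) {t e : A} → P → (if does P? then t else e) ≡ t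
  if-yes P? {t} {e} p = cong (λ b → if b then t else e) (dec-true P? p)

  if-no : ∀ {p a} {P : Set p} {A : Set a} (P? : Dec P) {t e : A} → ¬ P → (if does P? then t else e) ≡ e
  if-no P? {t} {e} ¬p = cong (λ b → if b then t else e) (dec-false P? ¬p)

  sum-map-≥ : ∀ {a} {A : Set a} (f : A → ℕ) {m} {xs} → All (λ y → m ≤ f y) xs → length xs * m ≤ sum (map f xs)
  sum-map-≥ f []       = z≤n
  sum-map-≥ f (p ∷ ps) = +-mono-≤ p (sum-map-≥ f ps)

  -- How FAST's estimates move

  module FASTAnalysis {a ℓ₁ ℓ₂ u} (F : FloorField a ℓ₁ ℓ₂) {U : Set u} (_≟_ : DecidableEquality U)
              (M : ℕ) (δ φ : FloorField.Carrier F)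
              (0<δ : FloorField._<_ F (FloorField.0# F) δ)
              (0≤φ : FloorField._≤_ F (FloorField.0# F) φ)
              (k : ℕ)
              (capacity : k * (M + 2 * (FAST.s F _≟_ M δ φ 0<δ 0≤φ ∸ 1)) ≤ M * FAST.ℭ F _≟_ M δ φ 0<δ 0≤φ) where
    open FAST F _≟_ M δ φ 0<δ 0≤φ
    open State
    open Data.List.Membership.DecPropositional _≟_ using (_∈?_)

    value : State → U → ℕ
    value S y = r S y + s * c S y

    ↦-same : ∀ (f : U → ℕ) x n → (f [ x ↦ n ]) x ≡ n
    ↦-same f x n = if-yes (x ≟ x) refl

    ↦-other : ∀ (f : U → ℕ) {x y} n → y ≢ x → (f [ x ↦ n ]) y ≡ f y
    ↦-other f {x} {y} n y≢x = if-no (y ≟ x) y≢x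

    -- Carrying from remainder to counter loses nothing; this is why both kinds of addition account
    -- for the weight exactly.
    %+*/ : ∀ n i → n % s + s * (i + n / s) ≡ n + s * i
    %+*/ n i = begin
      n % s + s * (i + n / s)     ≡⟨ solve 4 (λ R s i D → R :+ s :* (i :+ D) := (R :+ D :* s) :+ s :* i) refl (n % s) s i (n / s) ⟩
      (n % s + n / s * s) + s * i ≡⟨ cong (_+ s * i) (m≡m%n+[m/n]*n n s) ⟨
      n + s * i                   ∎
      where open ≡-Reasoning

    -- `remove` filters out every copy of `m`; `Unique` turns this into the removal of a single
    -- entry, so lengths and sums can be compared.
    remove-↭ : ∀ {m xs} → Unique xs → m ∈ xs → xs ↭ m ∷ remove m xs
    remove-↭ {m} {y ∷ ys} (y∉ys ∷ _) (here refl)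
      rewrite filter-reject (λ z → ¬? (z ≟ m)) {m} {ys} (λ m≢m → m≢m refl)
            | filter-all (λ z → ¬? (z ≟ m)) (All.map (_∘ sym) y∉ys) = ↭-refl
    remove-↭ {m} {y ∷ ys} (y∉ys ∷ ys!) (there m∈ys)
      rewrite filter-accept (λ z → ¬? (z ≟ m)) {y} {ys} (All.lookup y∉ys m∈ys) =
      ↭-trans (prep y (remove-↭ ys! m∈ys)) (swap y m ↭-refl)

    insert-∈ : ∀ {x xs} → x ∈ xs → insert x xs ≡ xs
    insert-∈ {x} {xs} = if-yes (x ∈? xs)

    insert-∉ : ∀ {x xs} → x ∉ xs → insert x xs ≡ x ∷ xs
    insert-∉ {x} {xs} = if-no (x ∈? xs)

    minimum-≤ : ∀ f {xs} → All (λ y → minimum f xs ≤ f y) xs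
    minimum-≤ f {[]}     = []
    minimum-≤ f {y ∷ ys} = min≤⊤ (f y) (map f ys) ∷ All.map⁻ (min≤xs (f y) (map f ys))

    ≤-minimum : ∀ f {m xs} → 0 < length xs → All (λ y → m ≤ f y) xs → m ≤ minimum f xs
    ≤-minimum f {xs = y ∷ ys} _ (p ∷ ps) = v≤min⁺ p (All.map⁺ ps)

    query-direct : ∀ S x → Direct S x → query S x ≡ value S x
    query-direct S x = if-yes (direct? S x)

    query-indirect : ∀ S x → ¬ Direct S x → query S x ≡ (s ∸ 1) + s * minimum (c S) (C S)
    query-indirect S x = if-no (direct? S x)

    -- `N` bounds the number of packets since the last flush. Evicted ids keep stale values of `c`
    -- and `r`; `fresh` says that these cannot be read while the table has room, because nothing has
    -- been evicted yet. A full table never gets smaller.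
    record Invariant (N : ℕ) (S : State) : Set u where
      field
        unique       : Unique (C S)
        length≤N     : length (C S) ≤ N
        remainder    : ∀ y → r S y ≤ s ∸ 1
        total        : sum (map (value S) (C S)) ≤ N * (M + (s ∸ 1))
        fresh        : length (C S) < ℭ → ∀ {y} → y ∉ C S → value S y ≡ 0
    open Invariant

    initial-invariant : ∀ N → Invariant N initial
    initial-invariant N = record
      { unique    = []
      ; length≤N  = z≤n
      ; remainder = λ _ → z≤n
      ; total     = z≤n
      ; fresh     = λ _ _ → *-zeroʳ s
      }

    query-initial : ∀ x → query initial x ≡ 0
    query-initial x = trans (query-direct initial x (inj₂ (>-nonZero⁻¹ ℭ))) (*-zeroʳ s)

    full : ∀ S x → ¬ Direct S x → ℭ ≤ length (C S)
    full S x ¬d = ≮⇒≥ (¬d ∘ inj₂)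

    -- A full table holds at least ℭ counters, which are worth at most N(M + s − 1)
    -- in total, and it takes N ≥ ℭ packets to fill it.
    query-indirect-≤ : ∀ {N S x} → Invariant N S → ¬ Direct S x → k * query S x ≤ M * N
    query-indirect-≤ {N} {S} {x} I ¬d = *-cancelˡ-≤ ℭ (begin
      ℭ * (k * query S x)                  ≡⟨ cong (λ q → ℭ * (k * q)) (query-indirect S x ¬d) ⟩
      ℭ * (k * (s ∸ 1 + s * μ))            ≡⟨ solve 4 (λ a b d e → a :* (b :* (d :+ e)) := b :* (a :* d :+ a :* e)) refl ℭ k (s ∸ 1) (s * μ) ⟩
      k * (ℭ * (s ∸ 1) + ℭ * (s * μ))      ≤⟨ *-monoʳ-≤ k (+-mono-≤ (*-monoˡ-≤ (s ∸ 1) (≤-trans (full S x ¬d) (length≤N I))) counters) ⟩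
      k * (N * (s ∸ 1) + N * (M + (s ∸ 1))) ≡⟨ solve 4 (λ k N M t → k :* (N :* t :+ N :* (M :+ t)) := N :* (k :* (M :+ con 2 :* t))) refl k N M (s ∸ 1) ⟩
      N * (k * (M + 2 * (s ∸ 1)))          ≤⟨ *-monoʳ-≤ N capacity ⟩
      N * (M * ℭ)                          ≡⟨ solve 3 (λ N M c → N :* (M :* c) := c :* (M :* N)) refl N M ℭ ⟩
      ℭ * (M * N)                          ∎)
      where
      open ≤-Reasoning
      μ : ℕ
      μ = minimum (c S) (C S)
      counters : ℭ * (s * μ) ≤ N * (M + (s ∸ 1))
      counters = begin
        ℭ * (s * μ)              ≤⟨ *-monoˡ-≤ (s * μ) (full S x ¬d) ⟩
        length (C S) * (s * μ)   ≤⟨ sum-map-≥ (value S) (All.map (λ {y} p → ≤-trans (*-monoʳ-≤ s p) (m≤n+m _ (r S y))) (minimum-≤ (c S) {C S})) ⟩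
        sum (map (value S) (C S)) ≤⟨ total I ⟩
        N * (M + (s ∸ 1))        ∎

    -- Covers the two kinds of id that a replacement leaves outside the table: those already absent,
    -- whose estimate comes from the minimum, and the evicted `m`, whose remainder is at most
    -- `s ∸ 1`.
    query-≤ : ∀ {N S} → Invariant N S → ∀ {x m} → ¬ Direct S x ⊎ x ≡ m → m ∈ C S →
              query S x ≤ (s ∸ 1) + s * c S m
    query-≤ {S = S} I {x} (inj₁ ¬d) m∈C = ≤-trans (≤-reflexive (query-indirect S x ¬d))
      (+-monoʳ-≤ (s ∸ 1) (*-monoʳ-≤ s (All.lookup (minimum-≤ (c S)) m∈C)))
    query-≤ {S = S} I {x} (inj₂ refl) m∈C = ≤-trans (≤-reflexive (query-direct S x (inj₁ m∈C)))
      (+-monoˡ-≤ (s * c S x) (remainder I x))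

    value-addDirect : ∀ S x w → value (addDirect S x w) x ≡ value S x + w
    value-addDirect S x w = begin
      value (addDirect S x w) x ≡⟨ cong₂ (λ i j → i + s * j) (↦-same (r S) x _) (↦-same (c S) x _) ⟩
      (r S x + w) % s + s * (c S x + (r S x + w) / s) ≡⟨ %+*/ (r S x + w) (c S x) ⟩
      r S x + w + s * c S x     ≡⟨ solve 3 (λ a b d → a :+ b :+ d := a :+ d :+ b) refl (r S x) w (s * c S x) ⟩
      value S x + w             ∎
      where open ≡-Reasoning

    value-addReplacing : ∀ m S x w → value (addReplacing m S x w) x ≡ (s ∸ 1) + s * c S m + w
    value-addReplacing m S x w = begin
      value (addReplacing m S x w) x ≡⟨ cong₂ (λ i j → i + s * j) (↦-same (r S) x _) (↦-same (c S) x _) ⟩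
      (s ∸ 1 + w) % s + s * (c S m + (s ∸ 1 + w) / s) ≡⟨ %+*/ (s ∸ 1 + w) (c S m) ⟩
      s ∸ 1 + w + s * c S m          ≡⟨ solve 3 (λ a b d → a :+ b :+ d := a :+ d :+ b) refl (s ∸ 1) w (s * c S m) ⟩
      (s ∸ 1) + s * c S m + w        ∎
      where open ≡-Reasoning

    %s≤ : ∀ n → n % s ≤ s ∸ 1
    %s≤ n = <⇒≤pred (m%n<n n s)

    remainder-↦ : ∀ {f : U → ℕ} x n → (∀ y → f y ≤ s ∸ 1) → ∀ y → (f [ x ↦ n % s ]) y ≤ s ∸ 1
    remainder-↦ {f} x n f≤ y with y ≟ x
    ... | yes _ = %s≤ n
    ... | no  _ = f≤ y

    sum-agree : ∀ {f g : U → ℕ} {x xs} → (∀ {y} → y ≢ x → f y ≡ g y) → x ∉ xs → sum (map f xs) ≡ sum (map g xs)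
    sum-agree {xs = xs} agree x∉xs = cong sum (map-cong-local
      (All.tabulate (λ y∈xs → agree (λ y≡x → x∉xs (subst (_∈ xs) y≡x y∈xs)))))

    ∉-remove : ∀ {m xs} → m ∉ remove m xs
    ∉-remove {m} {xs} m∈ = proj₂ (∈-filter⁻ (λ y → ¬? (y ≟ m)) {xs = xs} m∈) refl

    sum-remove : ∀ (f : U → ℕ) {m xs} → Unique xs → m ∈ xs → sum (map f xs) ≡ f m + sum (map f (remove m xs))
    sum-remove f xs! m∈xs = sum-↭ (map⁺ f (remove-↭ xs! m∈xs))

    addDirect-agree : ∀ S {x y} w → y ≢ x → value (addDirect S x w) y ≡ value S y
    addDirect-agree S w y≢x = cong₂ (λ i j → i + s * j) (↦-other (r S) _ y≢x) (↦-other (c S) _ y≢x)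

    addReplacing-agree : ∀ m S {x y} w → y ≢ x → value (addReplacing m S x w) y ≡ value S y
    addReplacing-agree m S w y≢x = cong₂ (λ i j → i + s * j) (↦-other (r S) _ y≢x) (↦-other (c S) _ y≢x)

    add-total-≤ : ∀ N {v v′ w} → w ≤ M → v′ ≤ v + w + (s ∸ 1) → v ≤ N * (M + (s ∸ 1)) →
                  v′ ≤ suc N * (M + (s ∸ 1))
    add-total-≤ N {v} {v′} {w} w≤M v′≤ v≤ = begin
      v′                                    ≤⟨ v′≤ ⟩
      v + w + (s ∸ 1)                       ≡⟨ +-assoc v w _ ⟩
      v + (w + (s ∸ 1))                     ≤⟨ +-mono-≤ v≤ (+-monoˡ-≤ (s ∸ 1) w≤M) ⟩
      N * (M + (s ∸ 1)) + (M + (s ∸ 1))     ≡⟨ +-comm (N * (M + (s ∸ 1))) _ ⟩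
      suc N * (M + (s ∸ 1))                 ∎
      where open ≤-Reasoning

    ∉-remove⁺ : ∀ {x m xs} → x ∉ xs → x ∉ remove m xs
    ∉-remove⁺ {m = m} x∉xs x∈ = x∉xs (proj₁ (∈-filter⁻ (λ y → ¬? (y ≟ m)) x∈))

    length-replace : ∀ {x m xs} → Unique xs → m ∈ xs → x ∉ xs → length (insert x (remove m xs)) ≡ length xs
    length-replace xs! m∈xs x∉xs =
      trans (cong length (insert-∉ (∉-remove⁺ x∉xs))) (sym (↭-length (remove-↭ xs! m∈xs)))

    add-invariant : ∀ {N S x w S′} → w ≤ M → Invariant N S → Add S x w S′ → Invariant (suc N) S′
    add-invariant {N} {S} {x} {w} w≤M I (direct d) = by-membership (x ∈? C S)
      where
      open ≤-Reasoning
      S′ : State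
      S′ = addDirect S x w
      by-membership : Dec (x ∈ C S) → Invariant (suc N) S′
      by-membership (yes x∈C) = record
        { unique    = subst Unique (sym C′≡) (unique I)
        ; length≤N  = subst ((_≤ suc N) ∘ length) (sym C′≡) (m≤n⇒m≤1+n (length≤N I))
        ; remainder = remainder-↦ x (r S x + w) (remainder I)
        ; total     = add-total-≤ N w≤M (begin
            sum (map (value S′) (C S′))                         ≡⟨ cong (sum ∘ map (value S′)) C′≡ ⟩
            sum (map (value S′) (C S))                          ≡⟨ sum-remove (value S′) (unique I) x∈C ⟩
            value S′ x + sum (map (value S′) (remove x (C S)))  ≡⟨ cong₂ _+_ (value-addDirect S x w) (sum-agree (addDirect-agree S w) (∉-remove {x} {C S})) ⟩
            value S x + w + sum (map (value S) (remove x (C S))) ≡⟨ solve 3 (λ a b d → a :+ b :+ d := a :+ d :+ b) refl (value S x) w _ ⟩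
            value S x + sum (map (value S) (remove x (C S))) + w ≡⟨ cong (_+ w) (sum-remove (value S) (unique I) x∈C) ⟨
            sum (map (value S) (C S)) + w                       ≤⟨ m≤m+n _ (s ∸ 1) ⟩
            sum (map (value S) (C S)) + w + (s ∸ 1)             ∎) (total I)
        ; fresh     = λ <ℭ {y} y∉C′ →
            let y∉C = subst (y ∉_) C′≡ y∉C′
            in  trans (addDirect-agree S w (λ y≡x → y∉C (subst (_∈ C S) (sym y≡x) x∈C)))
                      (fresh I (subst ((_< ℭ) ∘ length) C′≡ <ℭ) y∉C)
        }
        where
        C′≡ : C S′ ≡ C S
        C′≡ = insert-∈ x∈C
      by-membership (no x∉C) = record
        { unique    = subst Unique (sym C′≡) (All.¬Any⇒All¬ _ x∉C ∷ unique I)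
        ; length≤N  = subst ((_≤ suc N) ∘ length) (sym C′≡) (s≤s (length≤N I))
        ; remainder = remainder-↦ x (r S x + w) (remainder I)
        ; total     = add-total-≤ N w≤M (begin
            sum (map (value S′) (C S′))             ≡⟨ cong (sum ∘ map (value S′)) C′≡ ⟩
            value S′ x + sum (map (value S′) (C S)) ≡⟨ cong₂ _+_ (value-addDirect S x w) (sum-agree (addDirect-agree S w) x∉C) ⟩
            value S x + w + sum (map (value S) (C S)) ≡⟨ cong (λ v → v + w + sum (map (value S) (C S))) (fresh I <ℭ x∉C) ⟩
            w + sum (map (value S) (C S))           ≡⟨ +-comm w _ ⟩
            sum (map (value S) (C S)) + w           ≤⟨ m≤m+n _ (s ∸ 1) ⟩
            sum (map (value S) (C S)) + w + (s ∸ 1) ∎) (total I)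
        ; fresh     = λ _ {y} y∉C′ →
            let y∉xC = subst (y ∉_) C′≡ y∉C′
            in  trans (addDirect-agree S w (y∉xC ∘ here)) (fresh I <ℭ (y∉xC ∘ there))
        }
        where
        C′≡ : C S′ ≡ x ∷ C S
        C′≡ = insert-∉ x∉C
        <ℭ : length (C S) < ℭ
        <ℭ = fromInj₂ (λ x∈C → contradiction x∈C x∉C) d
    add-invariant {N} {S} {x} {w} w≤M I (replace ¬d m m∈C m-min)
      = record
      { unique    = subst Unique (sym C′≡) (All.¬Any⇒All¬ _ x∉ ∷ Unique.filter⁺ _ (unique I))
      ; length≤N  = ≤-trans (≤-reflexive length≡) (m≤n⇒m≤1+n (length≤N I))
      ; remainder = remainder-↦ x (s ∸ 1 + w) (remainder I)
      ; total     = add-total-≤ N w≤M (begin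
          sum (map (value S′) (C S′))             ≡⟨ cong (sum ∘ map (value S′)) C′≡ ⟩
          value S′ x + sum (map (value S′) (remove m (C S))) ≡⟨ cong₂ _+_ (value-addReplacing m S x w) (sum-agree (addReplacing-agree m S w) x∉) ⟩
          -- The evicted entry is worth at least `s * c S m`. Trading it for the new one therefore
          -- costs at most `s ∸ 1` besides the weight, which is the rate `M + (s ∸ 1)` in `total`.
          (s ∸ 1) + s * c S m + w + Σ             ≤⟨ +-monoˡ-≤ Σ (+-monoˡ-≤ w (+-monoʳ-≤ (s ∸ 1) (m≤n+m (s * c S m) (r S m)))) ⟩
          (s ∸ 1) + value S m + w + Σ             ≡⟨ solve 4 (λ a b d e → a :+ b :+ d :+ e := b :+ e :+ d :+ a) refl (s ∸ 1) (value S m) w Σ ⟩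
          value S m + Σ + w + (s ∸ 1)             ≡⟨ cong (λ v → v + w + (s ∸ 1)) (sum-remove (value S) (unique I) m∈C) ⟨
          sum (map (value S) (C S)) + w + (s ∸ 1) ∎) (total I)
      ; fresh     = λ <ℭ → contradiction (subst (_< ℭ) length≡ <ℭ) (¬d ∘ inj₂)
      }
      where
      open ≤-Reasoning
      S′ : State
      S′ = addReplacing m S x w
      Σ : ℕ
      Σ = sum (map (value S) (remove m (C S)))
      x∉ : x ∉ remove m (C S)
      x∉ = ∉-remove⁺ (¬d ∘ inj₁)
      C′≡ : C S′ ≡ x ∷ remove m (C S)
      C′≡ = insert-∉ x∉
      length≡ : length (C S′) ≡ length (C S)
      length≡ = length-replace (unique I) m∈C (¬d ∘ inj₁)

    ∈-insert : ∀ x xs → x ∈ insert x xs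
    ∈-insert x xs with x ∈? xs
    ... | yes x∈ = x∈
    ... | no  _  = here refl

    insert-⊇ : ∀ x {y xs} → y ∈ xs → y ∈ insert x xs
    insert-⊇ x {xs = xs} y∈ with x ∈? xs
    ... | yes _ = y∈
    ... | no  _ = there y∈

    insert-⁻ : ∀ {x y xs} → y ∈ insert x xs → y ≢ x → y ∈ xs
    insert-⁻ {x} {xs = xs} y∈ y≢x with x ∈? xs
    insert-⁻ y∈           y≢x | yes _ = y∈
    insert-⁻ (here y≡x)   y≢x | no  _ = contradiction y≡x y≢x
    insert-⁻ (there y∈xs) y≢x | no  _ = y∈xs

    length-insert : ∀ x xs → length xs ≤ length (insert x xs)
    length-insert x xs with x ∈? xs
    ... | yes _ = ≤-refl
    ... | no  _ = n≤1+n _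

    -- A replacement starts `x` at `(s ∸ 1) + s * c S m`. As `m` is a minimiser, this is what the
    -- query of the absent `x` returned already, so entering the table does not itself move the
    -- estimate.
    add-query-self : ∀ {S x w S′} → Add S x w S′ → query S′ x ≡ query S x + w
    add-query-self {S} {x} {w} (direct d) = begin
      query S′ x        ≡⟨ query-direct S′ x (inj₁ (∈-insert x (C S))) ⟩
      value S′ x        ≡⟨ value-addDirect S x w ⟩
      value S x + w     ≡⟨ cong (_+ w) (query-direct S x d) ⟨
      query S x + w     ∎
      where
      open ≡-Reasoning
      S′ : State
      S′ = addDirect S x w
    add-query-self {S} {x} {w} (replace ¬d m m∈C m-min) = begin
      query S′ x        ≡⟨ query-direct S′ x (inj₁ (∈-insert x (remove m (C S)))) ⟩
      value S′ x        ≡⟨ value-addReplacing m S x w ⟩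
      (s ∸ 1) + s * c S m + w ≡⟨ cong (λ i → (s ∸ 1) + s * i + w) (≤-antisym (≤-minimum (c S) (nonempty m∈C) m-min) (All.lookup (minimum-≤ (c S)) m∈C)) ⟩
      (s ∸ 1) + s * minimum (c S) (C S) + w ≡⟨ cong (_+ w) (query-indirect S x ¬d) ⟨
      query S x + w     ∎
      where
      open ≡-Reasoning
      S′ : State
      S′ = addReplacing m S x w
      nonempty : ∀ {m xs} → m ∈ xs → 0 < length xs
      nonempty (here _)  = z<s
      nonempty (there _) = z<s

    ≤-query-indirect : ∀ S x {q} → ¬ Direct S x → (∀ {y} → y ∈ C S → q ≤ (s ∸ 1) + s * c S y) → q ≤ query S x
    ≤-query-indirect S x ¬d bound =
      let 0<length         = <-≤-trans (>-nonZero⁻¹ ℭ) (full S x ¬d)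
          m , m∈C , m-min  = argmin-exists (c S) (C S) 0<length
      in  ≤-trans (bound m∈C) (≤-trans
            (+-monoʳ-≤ (s ∸ 1) (*-monoʳ-≤ s (≤-minimum (c S) 0<length m-min)))
            (≤-reflexive (sym (query-indirect S x ¬d))))

    add-agree : ∀ {S x w S′} → Add S x w S′ → ∀ {y} → y ≢ x → value S′ y ≡ value S y
    add-agree {S} (direct _)        = addDirect-agree S _
    add-agree {S} (replace _ m _ _) = addReplacing-agree m S _

    -- Ids other than the added one can lose direct access but never gain it: only `x` enters the
    -- table, and the table does not shrink.
    add-direct⁻ : ∀ {N S x w S′} → Invariant N S → Add S x w S′ → ∀ {y} → y ≢ x → Direct S′ y → Direct S y
    add-direct⁻ {S = S} {x} I (direct _) y≢x (inj₁ y∈C′) = inj₁ (insert-⁻ y∈C′ y≢x)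
    add-direct⁻ {S = S} {x} I (direct _) y≢x (inj₂ <ℭ)   = inj₂ (≤-<-trans (length-insert x (C S)) <ℭ)
    add-direct⁻ I (replace _ m _ _) y≢x (inj₁ y∈C′) =
      inj₁ (proj₁ (∈-filter⁻ (λ y → ¬? (y ≟ m)) (insert-⁻ y∈C′ y≢x)))
    add-direct⁻ {S = S} {x} I (replace ¬d m m∈C _) y≢x (inj₂ <ℭ) = inj₂ (subst (_< ℭ) length≡ <ℭ)
      where
      length≡ : length (insert x (remove m (C S))) ≡ length (C S)
      length≡ = length-replace (unique I) m∈C (¬d ∘ inj₁)

    -- Shows that silent changes are rises, entry by entry so that the new minimum need not be
    -- known. An id that was never added when the table fills had estimate 0. An id absent before
    -- had the old minimum, and the counters only grow. An evicted id had at most `s ∸ 1` above its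
    -- counter, and that counter was minimal.
    add-query-≤ : ∀ {N S x w S′} → Invariant N S → Add S x w S′ → ∀ {y} → y ≢ x → ¬ Direct S′ y →
                  ∀ {z} → z ∈ C S′ → query S y ≤ (s ∸ 1) + s * c S′ z
    add-query-≤ {S = S} {x} {w} I (direct d) {y} y≢x ¬d′ {z} z∈C′ with direct? S y
    ... | yes (inj₁ y∈C) = contradiction (inj₁ (insert-⊇ x y∈C)) ¬d′
    ... | yes (inj₂ <ℭ)  = ≤-trans (≤-reflexive (trans (query-direct S y (inj₂ <ℭ)) (fresh I <ℭ (λ y∈C → ¬d′ (inj₁ (insert-⊇ x y∈C)))))) z≤n
    ... | no ¬dy = ≤-trans (query-≤ I (inj₁ ¬dy) z∈C) (+-monoʳ-≤ (s ∸ 1) (*-monoʳ-≤ s c≤c′))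
      where
      z∈C : z ∈ C S
      z∈C with z ≟ x
      ... | no  z≢x  = insert-⁻ z∈C′ z≢x
      ... | yes refl = fromInj₁ (λ <ℭ → contradiction (inj₂ <ℭ) ¬dy) d
      c≤c′ : c S z ≤ c (addDirect S x w) z
      c≤c′ with z ≟ x
      ... | no  _    = ≤-refl
      ... | yes refl = m≤m+n _ _
    add-query-≤ {S = S} {x} {w} I (replace ¬d m m∈C m-min) {y} y≢x ¬d′ {z} z∈C′ =
      ≤-trans (query-≤ I y-case m∈C) (+-monoʳ-≤ (s ∸ 1) (*-monoʳ-≤ s cm≤))
      where
      y-case : ¬ Direct S y ⊎ y ≡ m
      y-case with direct? S y | y ≟ m
      ... | no ¬dy          | _       = inj₁ ¬dy
      ... | yes _           | yes y≡m = inj₂ y≡m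
      ... | yes (inj₂ <ℭ)   | no _    = contradiction (inj₂ <ℭ) ¬d
      ... | yes (inj₁ y∈C)  | no y≢m  = contradiction (inj₁ (insert-⊇ x (∈-filter⁺ (λ v → ¬? (v ≟ m)) y∈C y≢m))) ¬d′
      cm≤ : c S m ≤ c (addReplacing m S x w) z
      cm≤ with z ≟ x
      ... | yes refl = m≤m+n _ _
      ... | no  z≢x  = All.lookup m-min (proj₁ (∈-filter⁻ (λ v → ¬? (v ≟ m)) (insert-⁻ z∈C′ z≢x)))

    -- With `add-query-self`, this is all that the analysis of WFAST uses about the effect of an
    -- addition on estimates. The second alternative is the silent rise, and it also includes ids
    -- that stay absent without any change.
    add-query-other : ∀ {N S x w S′} → w ≤ M → Invariant N S → Add S x w S′ → ∀ {y} → y ≢ x →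
                      query S′ y ≡ query S y ⊎ (query S y ≤ query S′ y × k * query S′ y ≤ M * suc N)
    add-query-other {S = S} {S′ = S′} w≤M I A {y} y≢x with direct? S′ y
    ... | yes d′ = inj₁ (trans (query-direct S′ y d′) (trans (add-agree A y≢x) (sym (query-direct S y (add-direct⁻ I A y≢x d′)))))
    ... | no ¬d′ = inj₂ (≤-query-indirect S′ y ¬d′ (add-query-≤ I A y≢x ¬d′) , query-indirect-≤ (add-invariant w≤M I A) ¬d′)

  take-+ : ∀ {a} {A : Set a} m n (xs : List A) → take (m + n) xs ≡ take m xs ++ take n (drop m xs)
  take-+ zero    n xs       = refl
  take-+ (suc m) n []       = sym (take-[] n)
  take-+ (suc m) n (x ∷ xs) = cong (x ∷_) (take-+ m n xs)

  -- Histories: volumes and overflow counts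

  module History {u} {U : Set u} (_≟_ : DecidableEquality U) (M : ℕ) (x : U) where
    open Packet

    -- Histories are listed from the newest event to the oldest.
    record Event : Set u where
      field
        packet     : Packet U M
        overflowed : Bool
        estimate   : ℕ -- FAST's estimate for x right after the packet
    open Event public

    occurrences : List U → ℕ
    occurrences = length ∘ filter (_≟ x)

    occurrences-++ : ∀ xs ys → occurrences (xs ++ ys) ≡ occurrences xs + occurrences ys
    occurrences-++ xs ys = trans (cong length (filter-++ (_≟ x) xs ys)) (length-++ (filter (_≟ x) xs))

    occurrences-drop : ∀ n xs → occurrences (drop n xs) ≤ occurrences xs
    occurrences-drop zero    xs       = ≤-refl
    occurrences-drop (suc n) []       = ≤-refl
    occurrences-drop (suc n) (y ∷ xs) = begin
      occurrences (drop n xs)         ≤⟨ occurrences-drop n xs ⟩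
      occurrences xs                  ≤⟨ m≤n+m _ (occurrences [ y ]) ⟩
      occurrences [ y ] + occurrences xs ≡⟨ occurrences-++ [ y ] xs ⟨
      occurrences (y ∷ xs)            ∎
      where open ≤-Reasoning

    volumeOf : Stream U M → ℕ
    volumeOf ps = sum (map weight (filter (λ p → ident p ≟ x) ps))

    volumeOf-++ : ∀ ps qs → volumeOf (ps ++ qs) ≡ volumeOf ps + volumeOf qs
    volumeOf-++ ps qs = begin
      sum (map weight (filter P? (ps ++ qs)))                          ≡⟨ cong (sum ∘ map weight) (filter-++ P? ps qs) ⟩
      sum (map weight (filter P? ps ++ filter P? qs))                  ≡⟨ cong sum (map-++ weight (filter P? ps) _) ⟩
      sum (map weight (filter P? ps) ++ map weight (filter P? qs))     ≡⟨ sum-++ (map weight (filter P? ps)) _ ⟩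
      volumeOf ps + volumeOf qs                                        ∎
      where
      open ≡-Reasoning
      P? : (p : Packet U M) → Dec (ident p ≡ x)
      P? p = ident p ≟ x

    volumeOf-hit : ∀ {p ps} → ident p ≡ x → volumeOf (p ∷ ps) ≡ weight p + volumeOf ps
    volumeOf-hit p≡x = cong (sum ∘ map weight) (filter-accept (λ p → ident p ≟ x) p≡x)

    volumeOf-miss : ∀ {p ps} → ident p ≢ x → volumeOf (p ∷ ps) ≡ volumeOf ps
    volumeOf-miss p≢x = cong (sum ∘ map weight) (filter-reject (λ p → ident p ≟ x) p≢x)

    volumeOf-≤ : ∀ ps → volumeOf ps ≤ length ps * M
    volumeOf-≤ []       = z≤n
    volumeOf-≤ (p ∷ ps) with ident p ≟ x
    ... | yes _ = +-mono-≤ (weight≤M p) (volumeOf-≤ ps)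
    ... | no  _ = ≤-trans (volumeOf-≤ ps) (m≤n+m _ M)

    -- Oldest first, against the order of the history, to match the inner queues: pushes go to the
    -- end and pops come from the front.
    overflows : List Event → List U
    overflows []      = []
    overflows (e ∷ h) = overflows h ++ (if overflowed e then [ ident (packet e) ] else [])

    overflows-++ : ∀ g h → overflows (g ++ h) ≡ overflows h ++ overflows g
    overflows-++ []      h = sym (++-identityʳ _)
    overflows-++ (e ∷ g) h = trans (cong (_++ last) (overflows-++ g h)) (++-assoc (overflows h) _ last)
      where
      last : List U
      last = if overflowed e then [ ident (packet e) ] else []

    length-overflows : ∀ h → length (overflows h) ≤ length h
    length-overflows []      = z≤n
    length-overflows (e ∷ h) = begin
      length (overflows h ++ last)       ≡⟨ length-++ (overflows h) ⟩
      length (overflows h) + length last ≤⟨ +-mono-≤ (length-overflows h) (last≤1 (overflowed e)) ⟩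
      length h + 1                       ≡⟨ +-comm (length h) 1 ⟩
      suc (length h)                     ∎
      where
      open ≤-Reasoning
      last : List U
      last = if overflowed e then [ ident (packet e) ] else []
      last≤1 : ∀ b → length (if b then [ ident (packet e) ] else []) ≤ 1
      last≤1 true  = ≤-refl
      last≤1 false = z≤n

    hits : ℕ → List Event → ℕ
    hits m h = occurrences (overflows (take m h))

    volume : ℕ → List Event → ℕ
    volume m h = volumeOf (map packet (take m h))

    hits-+ : ∀ m n h → hits (m + n) h ≡ hits m h + hits n (drop m h)
    hits-+ m n h = begin
      hits (m + n) h                                                  ≡⟨ cong (occurrences ∘ overflows) (take-+ m n h) ⟩
      occurrences (overflows (take m h ++ take n (drop m h)))         ≡⟨ cong occurrences (overflows-++ (take m h) _) ⟩
      occurrences (overflows (take n (drop m h)) ++ overflows (take m h)) ≡⟨ occurrences-++ (overflows (take n (drop m h))) _ ⟩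
      hits n (drop m h) + hits m h                                    ≡⟨ +-comm (hits n (drop m h)) _ ⟩
      hits m h + hits n (drop m h)                                    ∎
      where open ≡-Reasoning

    volume-+ : ∀ m n h → volume (m + n) h ≡ volume m h + volume n (drop m h)
    volume-+ m n h = begin
      volume (m + n) h                                              ≡⟨ cong (volumeOf ∘ map packet) (take-+ m n h) ⟩
      volumeOf (map packet (take m h ++ take n (drop m h)))         ≡⟨ cong volumeOf (map-++ packet (take m h) _) ⟩
      volumeOf (map packet (take m h) ++ map packet (take n (drop m h))) ≡⟨ volumeOf-++ (map packet (take m h)) _ ⟩
      volume m h + volume n (drop m h)                              ∎
      where open ≡-Reasoning

    length-map-take : ∀ m h → length (map packet (take m h)) ≤ m
    length-map-take zero    h       = z≤n
    length-map-take (suc m) []      = z≤n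
    length-map-take (suc m) (e ∷ h) = s≤s (length-map-take m h)

    volume-≤ : ∀ m h → volume m h ≤ m * M
    volume-≤ m h = ≤-trans (volumeOf-≤ (map packet (take m h))) (*-monoˡ-≤ M (length-map-take m h))

    hits-[] : ∀ m → hits m [] ≡ 0
    hits-[] m = cong (occurrences ∘ overflows) (take-[] m)

    volume-[] : ∀ m → volume m [] ≡ 0
    volume-[] m = cong (volumeOf ∘ map packet) (take-[] m)

    hits-true : ∀ e m h → ident (packet e) ≡ x → overflowed e ≡ true → hits (suc m) (e ∷ h) ≡ suc (hits m h)
    hits-true e m h i≡x ov = begin
      occurrences (overflows (take m h) ++ (if overflowed e then [ i ] else [])) ≡⟨ cong (λ b → occurrences (overflows (take m h) ++ (if b then [ i ] else []))) ov ⟩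
      occurrences (overflows (take m h) ++ [ i ]) ≡⟨ occurrences-++ (overflows (take m h)) [ i ] ⟩
      hits m h + occurrences [ i ]                ≡⟨ cong (λ ys → hits m h + length ys) (filter-accept (_≟ x) i≡x) ⟩
      hits m h + 1                                ≡⟨ +-comm (hits m h) 1 ⟩
      suc (hits m h)                              ∎
      where
      open ≡-Reasoning
      i : U
      i = ident (packet e)

    hits-false : ∀ e m h → overflowed e ≡ false → hits (suc m) (e ∷ h) ≡ hits m h
    hits-false e m h ov = trans (cong (λ b → occurrences (overflows (take m h) ++ (if b then _ else []))) ov)
      (cong occurrences (++-identityʳ (overflows (take m h))))

    hits-miss : ∀ e m h → ident (packet e) ≢ x → hits (suc m) (e ∷ h) ≡ hits m h
    hits-miss e m h i≢x with overflowed e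
    ... | false = cong occurrences (++-identityʳ (overflows (take m h)))
    ... | true  = begin
      occurrences (overflows (take m h) ++ [ i ]) ≡⟨ occurrences-++ (overflows (take m h)) [ i ] ⟩
      hits m h + occurrences [ i ]                ≡⟨ cong (λ ys → hits m h + length ys) (filter-reject (_≟ x) i≢x) ⟩
      hits m h + 0                                ≡⟨ +-identityʳ (hits m h) ⟩
      hits m h                                    ∎
      where
      open ≡-Reasoning
      i : U
      i = ident (packet e)

    -- The queue of block queues

    module Queue (β : ℕ) where

      -- The queue b agrees with the history h: its newest block has seen l packets, each
      -- other one β packets, and e entries have been popped from the oldest block.
      Fits : ∀ (l e : ℕ) {n} → Vec (List U) n → List Event → Set u
      Fits l e []              h = ⊤
      Fits l e (z ∷ [])        h = z ≡ drop e (overflows (take l h))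
      Fits l e (z ∷ b@(_ ∷ _)) h = z ≡ overflows (take l h) × Fits β e b (drop l h)

      queued : ∀ {n} → Vec (List U) n → ℕ
      queued []      = 0
      queued (z ∷ b) = occurrences z + queued b

      queued-∷ʳ : ∀ {n} (b : Vec (List U) n) z → queued (b Vec.∷ʳ z) ≡ queued b + occurrences z
      queued-∷ʳ []      z = +-identityʳ _
      queued-∷ʳ (y ∷ b) z = trans (cong (occurrences y +_) (queued-∷ʳ b z)) (sym (+-assoc (occurrences y) _ _))

      queued-init : ∀ {n} (b : Vec (List U) (suc n)) → queued b ≡ queued (Vec.init b) + occurrences (Vec.last b)
      queued-init b = trans (cong queued (proj₂ (proj₂ (Vec.initLast b)))) (queued-∷ʳ (Vec.init b) (Vec.last b))

      fits-replicate : ∀ l e n → Fits l e (Vec.replicate n []) []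
      fits-replicate l e zero          = tt
      fits-replicate l e (suc zero)    = sym (trans (cong (drop e ∘ overflows) (take-[] l)) (drop-[] e))
      fits-replicate l e (suc (suc n)) = sym (cong overflows (take-[] l)) ,
        subst (Fits β e (Vec.replicate (suc n) [])) (sym (drop-[] l)) (fits-replicate β e (suc n))

      queued-replicate : ∀ n → queued (Vec.replicate n []) ≡ 0
      queued-replicate zero    = refl
      queued-replicate (suc n) = queued-replicate n

      -- The pops belong to the oldest block. Once it is gone, the next block is untouched, hence
      -- the 0.
      fits-init : ∀ {l e n} (b : Vec (List U) (suc n)) h → Fits l e b h → Fits l 0 (Vec.init b) h
      fits-init (z ∷ [])         h f        = tt
      fits-init (z ∷ z′ ∷ [])    h (eq , f) = eq
      fits-init (z ∷ z′ ∷ z″ ∷ b) h (eq , f) = eq , fits-init (z′ ∷ z″ ∷ b) _ f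

      fits-newBlock : ∀ {e n} (b : Vec (List U) (suc n)) h → Fits β e b h → Fits 0 0 ([] ∷ Vec.init b) h
      fits-newBlock (z ∷ [])     h f = refl
      fits-newBlock (z ∷ z′ ∷ b) h f = refl , fits-init (z ∷ z′ ∷ b) h f

      -- A block of `β` packets overflows at most `β` times, so `β` pops empty its queue. Discarding
      -- the tail queue at a new block thus forgets no id that the table still counts.
      fits-last : ∀ {n} (b : Vec (List U) (suc n)) h → Fits β β b h → Vec.last b ≡ []
      fits-last (z ∷ [])     h f       = trans f (drop-all β (overflows (take β h))
        (≤-trans (length-overflows (take β h)) (≤-trans (≤-reflexive (length-take β h)) (m⊓n≤m β _))))
      fits-last (z ∷ z′ ∷ b) h (_ , f) = fits-last (z′ ∷ b) _ f

      -- `drop 1` covers both branches of a pop, since on an empty queue it does nothing; `e` counts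
      -- attempts.
      fits-pop : ∀ {l e n} (b : Vec (List U) (suc n)) h → Fits l e b h →
                 Fits l (suc e) (Vec.init b Vec.∷ʳ drop 1 (Vec.last b)) h
      fits-pop {l} {e} (z ∷ []) h f = trans (cong (drop 1) f) (trans (drop-drop e 1 (overflows (take l h)))
        (cong (λ i → drop i (overflows (take l h))) (+-comm e 1)))
      fits-pop {e = e} (z ∷ z′ ∷ []) h (eq , f) = eq , fits-pop {β} {e} (z′ ∷ []) _ f
      fits-pop (z ∷ z′ ∷ z″ ∷ b) h (eq , f) = eq , fits-pop (z′ ∷ z″ ∷ b) _ f

      -- `NonZero n` keeps the newest block apart from the oldest. In a single queue, a push after
      -- more pops than entries would not commute with `drop e`.
      fits-push : ∀ {l e n} .{{_ : NonZero n}} (b : Vec (List U) (suc n)) v h → Fits l e b h →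
                  Fits (suc l) e ((Vec.head b ++ (if overflowed v then [ ident (packet v) ] else [])) ∷ Vec.tail b) (v ∷ h)
      fits-push {n = suc n} (z ∷ z′ ∷ b) v h (eq , f) = cong (_++ _) eq , f

      -- The e oldest packets of the oldest block overflowed at most e times, so that all their
      -- entries have been popped.
      queued-≤ : ∀ {l e n} → e ≤ β → (b : Vec (List U) (suc n)) → ∀ h → Fits l e b h →
                 ∀ m → m + e ≡ n * β + l → queued b ≤ hits m h
      queued-≤ {l} {e} e≤β (z ∷ []) h f m m+e≡l = begin
        occurrences z + 0                         ≡⟨ +-identityʳ _ ⟩
        occurrences z                             ≡⟨ cong occurrences f ⟩
        occurrences (drop e (overflows (take l h))) ≡⟨ cong (λ i → occurrences (drop e (overflows (take i h)))) m+e≡l ⟨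
        occurrences (drop e (overflows (take (m + e) h))) ≡⟨ cong (occurrences ∘ drop e ∘ overflows) (take-+ m e h) ⟩
        occurrences (drop e (overflows (take m h ++ old))) ≡⟨ cong (occurrences ∘ drop e) (overflows-++ (take m h) old) ⟩
        occurrences (drop e (overflows old ++ overflows (take m h))) ≤⟨ drop-prefix e (overflows old) (≤-trans (length-overflows old) (≤-trans (≤-reflexive (length-take e (drop m h))) (m⊓n≤m e _))) ⟩
        hits m h                                  ∎
        where
        open ≤-Reasoning
        old : List Event
        old = take e (drop m h)
        drop-prefix : ∀ n ys {zs} → length ys ≤ n → occurrences (drop n (ys ++ zs)) ≤ occurrences zs
        drop-prefix n       []       {zs} _      = occurrences-drop n zs
        drop-prefix (suc n) (y ∷ ys) (s≤s p) = drop-prefix n ys p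
      queued-≤ {l} {e} {suc n} e≤β (z ∷ z′ ∷ b) h (eq , f) m m+e≡ = begin
        occurrences z + queued (z′ ∷ b)     ≤⟨ +-mono-≤ (≤-reflexive (cong occurrences eq)) (queued-≤ e≤β (z′ ∷ b) (drop l h) f m′ m′+e≡) ⟩
        hits l h + hits m′ (drop l h)       ≡⟨ hits-+ l m′ h ⟨
        hits (l + m′) h                     ≡⟨ cong (λ i → hits i h) l+m′≡m ⟩
        hits m h                            ∎
        where
        open ≤-Reasoning
        m′ : ℕ
        m′ = n * β + β ∸ e
        m′+e≡ : m′ + e ≡ n * β + β
        m′+e≡ = m∸n+n≡m (≤-trans e≤β (m≤n+m β (n * β)))
        l+m′≡m : l + m′ ≡ m
        l+m′≡m = +-cancelʳ-≡ e (l + m′) m (trans (+-assoc l m′ e) (trans (cong (l +_) m′+e≡)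
          (trans (solve 3 (λ l a b → l :+ (a :+ b) := b :+ a :+ l) refl l (n * β) β) (sym m+e≡))))

      -- Gives up the oldest block, from which an unknown part has been popped, and counts the
      -- newest block and the complete ones in between. The induction reaches the oldest block with
      -- nothing left to count.
      ≤-queued : ∀ {l e n} → l ≤ β → (b : Vec (List U) (suc n)) → ∀ h → Fits l e b h →
                 ∀ m → m + β ≡ n * β + l → hits m h ≤ queued b
      ≤-queued {l} l≤β (z ∷ []) h f m m+β≡l = ≤-trans (≤-reflexive (cong (λ i → hits i h) m≡0)) z≤n
        where
        m≡0 : m ≡ 0
        m≡0 = n≤0⇒n≡0 (+-cancelʳ-≤ β m 0 (≤-trans (≤-reflexive m+β≡l) l≤β))
      ≤-queued {l} {e} {suc n} l≤β (z ∷ z′ ∷ b) h (eq , f) m m+β≡ = begin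
        hits m h                            ≡⟨ cong (λ i → hits i h) m≡ ⟩
        hits (l + n * β) h                  ≡⟨ hits-+ l (n * β) h ⟩
        hits l h + hits (n * β) (drop l h)  ≤⟨ +-mono-≤ (≤-reflexive (cong occurrences (sym eq))) (≤-queued ≤-refl (z′ ∷ b) (drop l h) f (n * β) refl) ⟩
        occurrences z + queued (z′ ∷ b)     ∎
        where
        open ≤-Reasoning
        m≡ : m ≡ l + n * β
        m≡ = +-cancelʳ-≡ β m (l + n * β) (trans m+β≡ (solve 3 (λ l a b → b :+ a :+ l := l :+ a :+ b) refl l (n * β) β))

  -- The two outcomes of a cyclic counter, used for offsets in a frame and, with modulus `β`, for
  -- offsets in a block.
  data Next (W o : ℕ) .{{_ : NonZero W}} : Set where
    inside : suc o < W → (o + 1) % W ≡ suc o → Next W o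
    wraps  : suc o ≡ W → (o + 1) % W ≡ 0 → Next W o

  next : ∀ {W o} .{{_ : NonZero W}} → o < W → Next W o
  next {W} {o} o<W with m≤n⇒m<n∨m≡n o<W
  ... | inj₁ 1+o<W = inside 1+o<W (trans (cong (_% W) (+-comm o 1)) (m<n⇒m%n≡m 1+o<W))
  ... | inj₂ 1+o≡W = wraps 1+o≡W (trans (cong (_% W) (trans (+-comm o 1) 1+o≡W)) (n%n≡0 W))

  -- Overflows and volume within frames

  module Frames {u} {U : Set u} (_≟_ : DecidableEquality U) (x : U)
                (W M k β T : ℕ) .{{_ : NonZero W}} .{{_ : NonZero M}} .{{_ : NonZero k}} .{{_ : NonZero β}} .{{_ : NonZero T}}
                (W≡k*β : W ≡ k * β) (T≡β*M : T ≡ β * M) where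
    open Packet
    open History _≟_ M x
    open Queue β

    -- The offset is 0 before any packet has arrived, so the first frame is one packet short.
    -- `suc (offset h)` then exceeds the length of the history by one, which `take` and `drop`
    -- absorb.
    offset : List Event → ℕ
    offset []      = 0
    offset (_ ∷ h) = (offset h + 1) % W

    offset<W : ∀ h → offset h < W
    offset<W []      = >-nonZero⁻¹ W
    offset<W (_ ∷ h) = m%n<n (offset h + 1) W

    blockOffset : List Event → ℕ
    blockOffset h = offset h % β

    -- As `β` divides `W`, every frame opens with a new block, and the block offset cycles
    -- undisturbed by the end of a frame.
    blockOffset-step : ∀ h → (offset h + 1) % W % β ≡ (blockOffset h + 1) % β
    blockOffset-step h = begin
      (o + 1) % W % β           ≡⟨ m∣n⇒o%n%m≡o%m β W (o + 1) (divides k W≡k*β) ⟩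
      (o + 1) % β               ≡⟨ %-distribˡ-+ o 1 β ⟩
      (o % β + 1 % β) % β       ≡⟨ cong (λ i → (i + 1 % β) % β) (m%n%n≡m%n o β) ⟨
      (o % β % β + 1 % β) % β   ≡⟨ %-distribˡ-+ (o % β) 1 β ⟨
      (o % β + 1) % β           ∎
      where
      open ≡-Reasoning
      o : ℕ
      o = offset h

    blockOffset<β : ∀ h → blockOffset h < β
    blockOffset<β h = m%n<n (offset h) β

    nextBlock : ∀ h → Next β (blockOffset h)
    nextBlock h = next (blockOffset<β h)

    crosses : ℕ → ℕ → Bool
    crosses p q = does (p / T <? q / T)

    current : List Event → ℕ
    current []      = 0
    current (e ∷ _) = estimate e

    -- FAST's estimate for x just before the next packet is added: FAST has been flushed if
    -- that packet starts a frame.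
    before : List Event → ℕ
    before h = if does ((offset h + 1) % W ℕₚ.≟ 0) then 0 else current h

    -- The interface between FAST and the counting argument. In `miss` the overflow flag is left
    -- free, because it concerns another id. The bound on a silent rise counts the packets of the
    -- frame up to and including `e`, of which there are at most `suc (offset (e ∷ h))`.
    data Step (h : List Event) (e : Event) : Set u where
      hit  : ident (packet e) ≡ x → estimate e ≡ before h + weight (packet e) →
             overflowed e ≡ crosses (before h) (estimate e) → Step h e
      miss : ident (packet e) ≢ x →
             estimate e ≡ before h ⊎ (before h ≤ estimate e × k * estimate e ≤ M * suc (offset (e ∷ h))) →
             Step h e

    data Valid : List Event → Set u where
      []  : Valid []
      _∷_ : ∀ {e h} → Step h e → Valid h → Valid (e ∷ h)

    valid-drop : ∀ m {h} → Valid h → Valid (drop m h)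
    valid-drop zero    v       = v
    valid-drop (suc m) []      = []
    valid-drop (suc m) (_ ∷ v) = valid-drop m v

    before-inside : ∀ {h} → (offset h + 1) % W ≡ suc (offset h) → before h ≡ current h
    before-inside {h} eq = if-no ((offset h + 1) % W ℕₚ.≟ 0) (λ eq0 → 0≢1+n (trans (sym eq0) eq))

    before-wraps : ∀ {h} → (offset h + 1) % W ≡ 0 → before h ≡ 0
    before-wraps {h} = if-yes ((offset h + 1) % W ℕₚ.≟ 0)

    k*T≡M*W : k * T ≡ M * W
    k*T≡M*W = begin
      k * T       ≡⟨ cong (k *_) T≡β*M ⟩
      k * (β * M) ≡⟨ solve 3 (λ k β M → k :* (β :* M) := M :* (k :* β)) refl k β M ⟩
      M * (k * β) ≡⟨ cong (M *_) W≡k*β ⟨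
      M * W       ∎
      where open ≡-Reasoning

    silent-< : ∀ {q n} → k * q ≤ M * n → n < W → q < T
    silent-< {q} {n} kq≤ n<W = *-cancelˡ-< k q T (≤-<-trans kq≤ (<-≤-trans (*-monoʳ-< M n<W) (≤-reflexive (sym k*T≡M*W))))

    silent-≤ : ∀ {q n} → k * q ≤ M * n → n ≤ W → q ≤ T
    silent-≤ kq≤ n≤W = *-cancelˡ-≤ k (≤-trans kq≤ (≤-trans (*-monoʳ-≤ M n≤W) (≤-reflexive (sym k*T≡M*W))))

    M≤T : M ≤ T
    M≤T = ≤-trans (m≤n*m M β) (≤-reflexive (sym T≡β*M))

    record Frame (h : List Event) : Set u where
      field
        volume≤  : volume (suc (offset h)) h ≤ current h
        ≤volume  : current h ≤ volume (suc (offset h)) h + T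
        -- A silent rise can reach T only at the very end of the frame.
        counted  : current h / T ≡ hits (suc (offset h)) h
                 ⊎ (hits (suc (offset h)) h ≡ 0 × suc (offset h) ≡ W × current h ≤ T)

    -- The frame that the next packet joins, after the flush if there is one. The exceptional case
    -- of `Frame.counted` has disappeared: it needs a complete frame, and then the flush has reset
    -- the estimate to 0.
    record Prior (o q : ℕ) (h : List Event) : Set u where
      field
        volume≤ : volume o h ≤ q
        ≤volume : q ≤ volume o h + T
        counted : q / T ≡ hits o h

    prior : ∀ {h} → Frame h → Prior ((offset h + 1) % W) (before h) h
    prior {h} fr with next (offset<W h)
    ... | wraps _ eq = subst₂ (λ o q → Prior o q h) (sym eq) (sym (before-wraps {h} eq)) record
      { volume≤ = z≤n ; ≤volume = z≤n ; counted = 0/n≡0 T }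
    ... | inside <W eq = subst₂ (λ o q → Prior o q h) (sym eq) (sym (before-inside {h} eq)) record
      { volume≤ = Frame.volume≤ fr
      ; ≤volume = Frame.≤volume fr
      ; counted = fromInj₁ (λ (_ , ≡W , _) → contradiction ≡W (<⇒≢ <W)) (Frame.counted fr)
      }

    -- An overflow is recorded once, however many multiples of `T` are crossed. Since `M ≤ T`, one
    -- packet crosses at most one.
    /-step : ∀ q {w} → w ≤ T → (q + w) / T ≤ suc (q / T)
    /-step q {w} w≤T = begin
      (q + w) / T     ≤⟨ /-monoˡ-≤ T (+-monoʳ-≤ q w≤T) ⟩
      (q + T) / T     ≡⟨ m+n/n q ⟩
      suc (q / T)     ∎
      where
      open ≤-Reasoning
      m+n/n : ∀ q → (q + T) / T ≡ suc (q / T)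
      m+n/n q = trans (+-distrib-/-∣ʳ q ∣-refl) (trans (cong (q / T +_) (n/n≡1 T)) (+-comm (q / T) 1))

    frame-step : ∀ {h e} → Step h e → Prior (offset (e ∷ h)) (before h) h → Frame (e ∷ h)
    frame-step {h} {e} (hit i≡x est ov) p = record
      { volume≤ = begin
          volume (suc o) (e ∷ h)         ≡⟨ volumeOf-hit i≡x ⟩
          w + volume o h                 ≤⟨ +-monoʳ-≤ w (Prior.volume≤ p) ⟩
          w + before h                   ≡⟨ +-comm w (before h) ⟩
          before h + w                   ≡⟨ est ⟨
          estimate e                     ∎
      ; ≤volume = begin
          estimate e                     ≡⟨ est ⟩
          before h + w                   ≤⟨ +-monoˡ-≤ w (Prior.≤volume p) ⟩
          volume o h + T + w             ≡⟨ solve 3 (λ a b d → a :+ b :+ d := d :+ a :+ b) refl (volume o h) T w ⟩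
          w + volume o h + T             ≡⟨ cong (_+ T) (volumeOf-hit i≡x) ⟨
          volume (suc o) (e ∷ h) + T     ∎
      ; counted = inj₁ (by-overflow (before h / T <? estimate e / T))
      }
      where
      open ≤-Reasoning
      o w : ℕ
      o = offset (e ∷ h)
      w = weight (packet e)
      by-overflow : Dec (before h / T < estimate e / T) → estimate e / T ≡ hits (suc o) (e ∷ h)
      by-overflow (yes p<q) = trans (≤-antisym
          (≤-trans (≤-reflexive (cong (_/ T) est)) (/-step (before h) (≤-trans (weight≤M (packet e)) M≤T))) p<q)
        (trans (cong suc (Prior.counted p)) (sym (hits-true e o h i≡x (trans ov (dec-true (_ <? _) p<q)))))
      by-overflow (no p≮q) = trans (≤-antisym (≮⇒≥ p≮q)
          (/-monoˡ-≤ T (≤-trans (m≤m+n (before h) w) (≤-reflexive (sym est)))))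
        (trans (Prior.counted p) (sym (hits-false e o h (trans ov (dec-false (_ <? _) p≮q)))))
    frame-step {h} {e} (miss i≢x (inj₁ est)) p = record
      { volume≤ = ≤-trans (≤-reflexive (volumeOf-miss i≢x)) (≤-trans (Prior.volume≤ p) (≤-reflexive (sym est)))
      ; ≤volume = ≤-trans (≤-reflexive est) (≤-trans (Prior.≤volume p) (≤-reflexive (cong (_+ T) (sym (volumeOf-miss i≢x)))))
      ; counted = inj₁ (trans (cong (_/ T) est) (trans (Prior.counted p) (sym (hits-miss e (offset (e ∷ h)) h i≢x))))
      }
    frame-step {h} {e} (miss i≢x (inj₂ (b≤ , small))) p = record
      { volume≤ = ≤-trans (≤-reflexive (volumeOf-miss i≢x)) (≤-trans (Prior.volume≤ p) b≤)
      ; ≤volume = ≤-trans ≤T (m≤n+m T _)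
      ; counted = by-size (estimate e <? T) (before h <? T)
      }
      where
      o : ℕ
      o = offset (e ∷ h)
      ≤T : estimate e ≤ T
      ≤T = silent-≤ small (offset<W (e ∷ h))
      hits≡ : hits (suc o) (e ∷ h) ≡ before h / T
      hits≡ = trans (hits-miss e o h i≢x) (sym (Prior.counted p))
      -- A silent rise ends at `T` at the latest. If it ends below `T`, both quotients are 0; if it
      -- starts at `T` or above, it is no rise. Only the passage from below `T` to `T` itself goes
      -- unrecorded, and `silent-<` confines it to the last packet of the frame.
      by-size : Dec (estimate e < T) → Dec (before h < T) →
                estimate e / T ≡ hits (suc o) (e ∷ h) ⊎ (hits (suc o) (e ∷ h) ≡ 0 × suc o ≡ W × estimate e ≤ T)
      by-size (yes e<T) _         = inj₁ (trans (m<n⇒m/n≡0 e<T) (sym (trans hits≡ (m<n⇒m/n≡0 (≤-<-trans b≤ e<T)))))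
      by-size (no e≮T)  (yes b<T) = inj₂ (trans hits≡ (m<n⇒m/n≡0 b<T)
        , ≤-antisym (offset<W (e ∷ h)) (≮⇒≥ (λ <W → e≮T (silent-< small <W))) , ≤T)
      by-size (no e≮T)  (no b≮T)  = inj₁ (trans (cong (_/ T) (≤-antisym (≤-trans ≤T (≮⇒≥ b≮T)) b≤)) (sym hits≡))

    frame : ∀ {h} → Valid h → Frame h
    frame []      = record { volume≤ = z≤n ; ≤volume = z≤n ; counted = inj₁ (0/n≡0 T) }
    frame (s ∷ v) = frame-step s (prior (frame v))

    -- This bound and the next one hold in the exceptional case too, where there are no overflows
    -- and the estimate is at most `T`, so `segment-bounds` need not treat that case apart.
    hits*T≤current : ∀ {h} → Frame h → hits (suc (offset h)) h * T ≤ current h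
    hits*T≤current {h} fr with Frame.counted fr
    ... | inj₁ eq           = subst (λ n → n * T ≤ current h) eq (m/n*n≤m (current h) T)
    ... | inj₂ (n≡0 , _)    = subst (λ n → n * T ≤ current h) (sym n≡0) z≤n

    current≤hits*T+T : ∀ {h} → Frame h → current h ≤ hits (suc (offset h)) h * T + T
    current≤hits*T+T {h} fr with Frame.counted fr
    ... | inj₂ (_ , _ , ≤T) = ≤-trans ≤T (m≤n+m T _)
    ... | inj₁ eq           = begin
      current h                               ≡⟨ m≡m%n+[m/n]*n (current h) T ⟩
      current h % T + current h / T * T       ≤⟨ +-monoˡ-≤ _ (m%n≤n (current h) T) ⟩
      T + current h / T * T                   ≡⟨ cong (λ n → T + n * T) eq ⟩
      T + hits (suc (offset h)) h * T         ≡⟨ +-comm T _ ⟩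
      hits (suc (offset h)) h * T + T         ∎
      where open ≤-Reasoning

    offset-drop : ∀ m h → m ≤ offset h → m + offset (drop m h) ≡ offset h
    offset-drop zero    h       _  = refl
    offset-drop (suc m) (e ∷ h) m< with next (offset<W h)
    ... | wraps _ eq  = contradiction (≤-trans m< (≤-reflexive eq)) λ()
    ... | inside _ eq = trans (cong suc (offset-drop m h (s≤s⁻¹ (≤-trans m< (≤-reflexive eq))))) (sym eq)

    -- After its last silent rise, which leaves it at most T, the estimate grows exactly by
    -- the weights of x.
    segment : ∀ {h} m → Valid h → m ≤ offset h →
              current (drop m h) + volume m h ≤ current h ×
              (current h ≤ current (drop m h) + volume m h ⊎ current h ≤ volume m h + T)
    segment {h} zero v _ = ≤-reflexive (+-identityʳ _) , inj₁ (≤-reflexive (sym (+-identityʳ (current h))))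
    segment {e ∷ h} (suc m) (s ∷ v) m< with next (offset<W h)
    ... | wraps _ eq  = contradiction (≤-trans m< (≤-reflexive eq)) λ()
    ... | inside _ eq with segment m v (s≤s⁻¹ (≤-trans m< (≤-reflexive eq)))
    ...   | lo , hi = extend s
      where
      open ≤-Reasoning
      p w V : ℕ
      p = current (drop m h)
      w = weight (packet e)
      V = volume m h
      b≡ : before h ≡ current h
      b≡ = before-inside {h} eq
      Grown : ℕ → ℕ → Set
      Grown v q = p + v ≤ q × (q ≤ p + v ⊎ q ≤ v + T)
      extend : Step h e → Grown (volume (suc m) (e ∷ h)) (estimate e)
      extend (hit i≡x est _) = subst₂ Grown (sym (volumeOf-hit i≡x)) (sym (trans est (cong (_+ w) b≡)))
        ((begin
          p + (w + V)     ≡⟨ p+[w+V] ⟩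
          p + V + w       ≤⟨ +-monoˡ-≤ w lo ⟩
          current h + w   ∎) , Sum.map
            (λ q≤ → ≤-trans (+-monoˡ-≤ w q≤) (≤-reflexive (sym p+[w+V])))
            (λ q≤ → ≤-trans (+-monoˡ-≤ w q≤) (≤-reflexive (solve 3 (λ T w V → V :+ T :+ w := w :+ V :+ T) refl T w V)))
            hi)
        where
        p+[w+V] : p + (w + V) ≡ p + V + w
        p+[w+V] = solve 3 (λ p w V → p :+ (w :+ V) := p :+ V :+ w) refl p w V
      extend (miss i≢x (inj₁ est)) = subst₂ Grown (sym (volumeOf-miss i≢x)) (sym (trans est b≡)) (lo , hi)
      extend (miss i≢x (inj₂ (b≤ , small))) = subst (λ v → Grown v (estimate e)) (sym (volumeOf-miss i≢x))
        (≤-trans lo (subst (_≤ estimate e) b≡ b≤) , inj₂ (≤-trans (silent-≤ small (offset<W (e ∷ h))) (m≤n+m T V)))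

    -- The overflows of the segment are those of the frame so far, less the `n₁` that precede it.
    -- Both totals are roundings to multiples of `T`, at the two ends of the segment; in each
    -- direction only one of the roundings is unfavourable, so a single `T` is lost.
    segment-bounds : ∀ {h} m → Valid h → m ≤ offset h →
                     volume m h ≤ hits m h * T + T × hits m h * T ≤ volume m h + T
    segment-bounds {h} m v m≤ with segment m v m≤
    ... | lo , hi = +-cancelˡ-≤ p _ _ below , +-cancelˡ-≤ (n₁ * T) _ _ (above hi)
      where
      open ≤-Reasoning
      g : List Event
      g = drop m h
      p q V n₁ n : ℕ
      p  = current g
      q  = current h
      V  = volume m h
      n₁ = hits (suc (offset g)) g
      n  = hits m h
      frame-h : Frame h
      frame-h = frame v
      frame-g : Frame g
      frame-g = frame (valid-drop m v)
      n-split : hits (suc (offset h)) h ≡ n + n₁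
      n-split = trans (cong (λ i → hits i h) (trans (cong suc (sym (offset-drop m h m≤))) (sym (+-suc m (offset g))))) (hits-+ m (suc (offset g)) h)
      below : p + V ≤ p + (n * T + T)
      below = begin
        p + V                ≤⟨ lo ⟩
        q                    ≤⟨ current≤hits*T+T frame-h ⟩
        hits (suc (offset h)) h * T + T ≡⟨ cong (λ i → i * T + T) n-split ⟩
        (n + n₁) * T + T     ≡⟨ solve 3 (λ n n₁ T → (n :+ n₁) :* T :+ T := n₁ :* T :+ (n :* T :+ T)) refl n n₁ T ⟩
        n₁ * T + (n * T + T) ≤⟨ +-monoˡ-≤ _ (hits*T≤current frame-g) ⟩
        p + (n * T + T)      ∎
      total≤q : n₁ * T + n * T ≤ q
      total≤q = begin
        n₁ * T + n * T       ≡⟨ solve 3 (λ n n₁ T → n₁ :* T :+ n :* T := (n :+ n₁) :* T) refl n n₁ T ⟩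
        (n + n₁) * T         ≡⟨ cong (_* T) n-split ⟨
        hits (suc (offset h)) h * T ≤⟨ hits*T≤current frame-h ⟩
        q                    ∎
      above : q ≤ p + V ⊎ q ≤ V + T → n₁ * T + n * T ≤ n₁ * T + (V + T)
      above (inj₁ q≤) = begin
        n₁ * T + n * T       ≤⟨ total≤q ⟩
        q                    ≤⟨ q≤ ⟩
        p + V                ≤⟨ +-monoˡ-≤ V (current≤hits*T+T frame-g) ⟩
        n₁ * T + T + V       ≡⟨ solve 3 (λ a b d → a :+ b :+ d := a :+ (d :+ b)) refl (n₁ * T) T V ⟩
        n₁ * T + (V + T)     ∎
      above (inj₂ q≤) = begin
        n₁ * T + n * T       ≤⟨ total≤q ⟩
        q                    ≤⟨ q≤ ⟩
        V + T                ≤⟨ m≤n+m _ (n₁ * T) ⟩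
        n₁ * T + (V + T)     ∎

    -- `drop (offset h) h` has offset 0: it is empty, or its newest packet opened the current frame
    -- and what lies below it is a completed frame.
    previous-frame : ∀ h → drop (suc (offset h)) h ≡ [] ⊎ suc (offset (drop (suc (offset h)) h)) ≡ W
    previous-frame h = split (drop (offset h) h) (drop-suc (offset h) h) offset≡0
      where
      offset≡0 : offset (drop (offset h) h) ≡ 0
      offset≡0 = +-cancelˡ-≡ (offset h) _ 0 (trans (offset-drop (offset h) h ≤-refl) (sym (+-identityʳ _)))
      drop-suc : ∀ m (h : List Event) → drop (suc m) h ≡ drop 1 (drop m h)
      drop-suc m h = trans (cong (λ i → drop i h) (+-comm 1 m)) (sym (drop-drop m 1 h))
      split : ∀ g {g′} → g′ ≡ drop 1 g → offset g ≡ 0 → g′ ≡ [] ⊎ suc (offset g′) ≡ W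
      split []      refl _ = inj₁ refl
      split (e ∷ g) refl o≡0 with next (offset<W g)
      ... | wraps eq _  = inj₂ eq
      ... | inside _ eq = contradiction (trans (sym eq) o≡0) λ()

    -- Of the `m` window packets in the previous frame, the `l` newest surely have their overflows
    -- queued. The other `r` lie in the partly popped oldest block and weigh at most `β * M`, that
    -- is `T`; rounding in the segment costs the other `T`.
    previous-bounds : ∀ {g} l m r → (g ≡ [] ⊎ suc (offset g) ≡ W) → Valid g → l + r ≡ m → m < W → r ≤ β →
                      volume m g ≤ hits l g * T + 2 * T × hits m g * T ≤ volume m g + T
    previous-bounds l m r (inj₁ refl) v _ _ _ rewrite volume-[] m | hits-[] l | hits-[] m = z≤n , z≤n
    previous-bounds {g} l m r (inj₂ eq) v refl m<W r≤β = (begin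
        volume (l + r) g                       ≡⟨ volume-+ l r g ⟩
        volume l g + volume r (drop l g)       ≤⟨ +-mono-≤ (proj₁ (segment-bounds l v (≤-trans (m≤m+n l r) m≤))) (volume-≤ r (drop l g)) ⟩
        hits l g * T + T + r * M               ≤⟨ +-monoʳ-≤ (hits l g * T + T) (≤-trans (*-monoˡ-≤ M r≤β) (≤-reflexive (sym T≡β*M))) ⟩
        hits l g * T + T + T                   ≡⟨ solve 2 (λ a T → a :+ T :+ T := a :+ con 2 :* T) refl (hits l g * T) T ⟩
        hits l g * T + 2 * T                   ∎)
      , proj₂ (segment-bounds (l + r) v m≤)
      where
      open ≤-Reasoning
      m≤ : l + r ≤ offset g
      m≤ = s≤s⁻¹ (≤-trans m<W (≤-reflexive (sym eq)))

    -- WinQuery as a function of the number of queued entries. With none it uses `q` without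
    -- reduction, which is right even when a silent rise has brought `q` to `T`.
    estimated : ℕ → ℕ → ℕ
    estimated zero      q = 2 * T + q
    estimated n@(suc _) q = T * (n + 2) + q % T

    estimated-bounds : ∀ {h} → Valid h → ∀ n L → L + β ≡ W + suc (blockOffset h) →
                       hits L h ≤ n → n ≤ hits W h →
                       volume W h ≤ estimated n (current h) × estimated n (current h) ≤ volume W h + 4 * T
    estimated-bounds {h} v n L L+β≡ L≤n n≤W =
        (begin
          volume W h                                ≡⟨ volume≡ ⟩
          volume (suc o) h + volume m g             ≤⟨ +-mono-≤ (Frame.volume≤ fr) (proj₁ prev) ⟩
          q + (hits l g * T + 2 * T)                ≤⟨ +-monoʳ-≤ q (+-monoˡ-≤ (2 * T) (*-monoˡ-≤ T l≤n₂)) ⟩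
          q + (n₂ * T + 2 * T)                      ≡⟨ estimated≡ ⟨
          estimated n q                             ∎)
      , (begin
          estimated n q                             ≡⟨ estimated≡ ⟩
          q + (n₂ * T + 2 * T)                      ≤⟨ +-mono-≤ (Frame.≤volume fr) (+-monoˡ-≤ (2 * T) (≤-trans (*-monoˡ-≤ T n₂≤m) (proj₂ prev))) ⟩
          volume (suc o) h + T + (volume m g + T + 2 * T) ≡⟨ solve 3 (λ a b T → a :+ T :+ (b :+ T :+ con 2 :* T) := a :+ b :+ con 4 :* T) refl (volume (suc o) h) (volume m g) T ⟩
          volume (suc o) h + volume m g + 4 * T     ≡⟨ cong (_+ 4 * T) volume≡ ⟨
          volume W h + 4 * T                        ∎)
      where
      open ≤-Reasoning
      o t q m r l n₁ n₂ : ℕ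
      g : List Event
      o = offset h
      t = o % β
      q = current h
      g = drop (suc o) h
      m = W ∸ suc o
      r = β ∸ suc t
      l = L ∸ suc o
      n₁ = hits (suc o) h
      n₂ = n ∸ n₁
      fr : Frame h
      fr = frame v
      o+m≡W : suc o + m ≡ W
      o+m≡W = m+[n∸m]≡n (offset<W h)
      t+r≡β : suc t + r ≡ β
      t+r≡β = m+[n∸m]≡n (m%n<n o β)
      -- The current frame contains `o / β` complete blocks, and `o / β < k`. It therefore lies
      -- within the newest `L` packets, none of its overflows has been popped, and the subtraction
      -- in `n₂` is not truncated.
      o+β≤W+t : o + β ≤ W + t
      o+β≤W+t = begin
        o + β                 ≡⟨ cong (_+ β) (m≡m%n+[m/n]*n o β) ⟩
        t + o / β * β + β     ≡⟨ solve 3 (λ t a b → t :+ a :+ b := b :+ a :+ t) refl t (o / β * β) β ⟩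
        suc (o / β) * β + t   ≤⟨ +-monoˡ-≤ t (*-monoˡ-≤ β (m<n*o⇒m/o<n {n = k} (<-≤-trans (offset<W h) (≤-reflexive W≡k*β)))) ⟩
        k * β + t             ≡⟨ cong (_+ t) W≡k*β ⟨
        W + t                 ∎
      o<L : suc o ≤ L
      o<L = +-cancelʳ-≤ β (suc o) L (begin
        suc o + β   ≤⟨ s≤s o+β≤W+t ⟩
        suc (W + t) ≡⟨ +-suc W t ⟨
        W + suc t   ≡⟨ L+β≡ ⟨
        L + β       ∎)
      o+l≡L : suc o + l ≡ L
      o+l≡L = m+[n∸m]≡n o<L
      l+r≡m : l + r ≡ m
      l+r≡m = +-cancelˡ-≡ (suc o + suc t) _ _ (begin-equality
        suc o + suc t + (l + r)       ≡⟨ solve 4 (λ a b d e → a :+ b :+ (d :+ e) := a :+ d :+ (b :+ e)) refl (suc o) (suc t) l r ⟩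
        suc o + l + (suc t + r)       ≡⟨ cong₂ _+_ o+l≡L t+r≡β ⟩
        L + β                         ≡⟨ L+β≡ ⟩
        W + suc t                     ≡⟨ cong (_+ suc t) o+m≡W ⟨
        suc o + m + suc t             ≡⟨ solve 3 (λ a b d → a :+ b :+ d := a :+ d :+ b) refl (suc o) m (suc t) ⟩
        suc o + suc t + m             ∎)
      prev : volume m g ≤ hits l g * T + 2 * T × hits m g * T ≤ volume m g + T
      prev = previous-bounds l m r (previous-frame h) (valid-drop (suc o) v) l+r≡m
        (≤-trans (s≤s (m≤n+m m o)) (≤-reflexive o+m≡W)) (m∸n≤m β (suc t))
      volume≡ : volume W h ≡ volume (suc o) h + volume m g
      volume≡ = trans (cong (λ i → volume i h) (sym o+m≡W)) (volume-+ (suc o) m h)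
      split : ∀ {i j} → suc o + i ≡ j → hits j h ≡ n₁ + hits i (drop (suc o) h)
      split {i} eq = trans (cong (λ i → hits i h) (sym eq)) (hits-+ (suc o) i h)
      n₁+n₂≡n : n₁ + n₂ ≡ n
      n₁+n₂≡n = m+[n∸m]≡n (≤-trans (≤-trans (m≤m+n n₁ _) (≤-reflexive (sym (split o+l≡L)))) L≤n)
      l≤n₂ : hits l g ≤ n₂
      l≤n₂ = +-cancelˡ-≤ n₁ _ _ (≤-trans (≤-reflexive (sym (split o+l≡L))) (≤-trans L≤n (≤-reflexive (sym n₁+n₂≡n))))
      n₂≤m : n₂ ≤ hits m g
      n₂≤m = +-cancelˡ-≤ n₁ _ _ (≤-trans (≤-reflexive n₁+n₂≡n) (≤-trans n≤W (≤-reflexive (split o+m≡W))))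
      estimated≡ : estimated n q ≡ q + (n₂ * T + 2 * T)
      estimated≡ = by-count n n₁+n₂≡n (Frame.counted fr)
        where
        by-count : ∀ n → n₁ + n₂ ≡ n → q / T ≡ n₁ ⊎ (n₁ ≡ 0 × suc o ≡ W × q ≤ T) →
                   estimated n q ≡ q + (n₂ * T + 2 * T)
        by-count zero eq _ rewrite m+n≡0⇒n≡0 n₁ eq = +-comm (2 * T) q
        by-count n@(suc _) eq (inj₁ q/T≡n₁) = begin-equality
          T * (n + 2) + q % T             ≡⟨ cong (λ i → T * (i + 2) + q % T) eq ⟨
          T * (n₁ + n₂ + 2) + q % T       ≡⟨ solve 4 (λ T a b c → T :* (a :+ b :+ con 2) :+ c := c :+ a :* T :+ (b :* T :+ con 2 :* T)) refl T n₁ n₂ (q % T) ⟩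
          q % T + n₁ * T + (n₂ * T + 2 * T) ≡⟨ cong (λ i → q % T + i * T + (n₂ * T + 2 * T)) q/T≡n₁ ⟨
          q % T + q / T * T + (n₂ * T + 2 * T) ≡⟨ cong (_+ (n₂ * T + 2 * T)) (m≡m%n+[m/n]*n q T) ⟨
          q + (n₂ * T + 2 * T)            ∎
        -- In the exceptional case the window is the current frame, so `n₂` vanishes together with
        -- `n₁`, and the table cannot hold a positive count.
        by-count (suc _) eq (inj₂ (n₁≡0 , o≡W , _)) = contradiction (trans (sym eq) (cong₂ _+_ n₁≡0 n₂≡0)) λ()
          where
          m≡0 : m ≡ 0
          m≡0 = m≤n⇒m∸n≡0 (≤-reflexive (sym o≡W))
          n₂≡0 : n₂ ≡ 0
          n₂≡0 = n≤0⇒n≡0 (≤-trans n₂≤m (≤-reflexive (cong (λ i → hits i g) m≡0)))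

    tableEntry : ℕ → Maybe ℕ
    tableEntry zero      = nothing
    tableEntry n@(suc _) = just n

    -- `fits` has the same number twice because each addition pops once from the oldest block and
    -- adds one packet to the newest.
    record Consistent (h : List Event) (q o : ℕ) {n} (b : Vec (List U) n) (entry : Maybe ℕ) : Set u where
      field
        valid   : Valid h
        queried : q ≡ current h
        o≡      : o ≡ offset h
        fits    : Fits (suc (blockOffset h)) (suc (blockOffset h)) b h
        entry≡  : entry ≡ tableEntry (queued b)

  -- The window as a prefix of the history

  module _ {u} {U : Set u} (_≟_ : DecidableEquality U) {M : ℕ} (x : U) where
    open History _≟_ M x

    volumeOf-reverse : ∀ ps → volumeOf (reverse ps) ≡ volumeOf ps
    volumeOf-reverse []       = refl
    volumeOf-reverse (p ∷ ps) = begin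
      volumeOf (reverse (p ∷ ps))          ≡⟨ cong volumeOf (unfold-reverse p ps) ⟩
      volumeOf (reverse ps ++ [ p ])       ≡⟨ volumeOf-++ (reverse ps) [ p ] ⟩
      volumeOf (reverse ps) + volumeOf [ p ] ≡⟨ cong (_+ volumeOf [ p ]) (volumeOf-reverse ps) ⟩
      volumeOf ps + volumeOf [ p ]         ≡⟨ +-comm (volumeOf ps) _ ⟩
      volumeOf [ p ] + volumeOf ps         ≡⟨ volumeOf-++ [ p ] ps ⟨
      volumeOf (p ∷ ps)                    ∎
      where open ≡-Reasoning

    take-reverse : ∀ W (ps : Stream U M) → take W (reverse ps) ≡ reverse (drop (length ps ∸ W) ps)
    take-reverse W ps with ≤-total (length ps) W
    ... | inj₁ ≤W rewrite m≤n⇒m∸n≡0 ≤W = take-all W (reverse ps) (≤-trans (≤-reflexive (length-reverse ps)) ≤W)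
    ... | inj₂ W≤ = begin
      take W (reverse ps)                                   ≡⟨ cong (take W ∘ reverse) (take++drop≡id d ps) ⟨
      take W (reverse (take d ps ++ drop d ps))             ≡⟨ cong (take W) (reverse-++ (take d ps) (drop d ps)) ⟩
      take W (reverse (drop d ps) ++ reverse (take d ps))   ≡⟨ take-++-length W (reverse (drop d ps)) length≡ ⟩
      reverse (drop d ps)                                   ∎
      where
      open ≡-Reasoning
      d : ℕ
      d = length ps ∸ W
      length≡ : length (reverse (drop d ps)) ≡ W
      length≡ = trans (length-reverse (drop d ps)) (trans (length-drop d ps) (m∸[m∸n]≡n W≤))
      take-++-length : ∀ n (xs {ys} : Stream U M) → length xs ≡ n → take n (xs ++ ys) ≡ xs
      take-++-length zero    []       _  = refl
      take-++-length (suc n) (x ∷ xs) eq = cong (x ∷_) (take-++-length n xs (suc-injective eq))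

    windowVolume-history : ∀ W ps h → map packet h ≡ reverse ps → windowVolume _≟_ W ps x ≡ volume W h
    windowVolume-history W ps h eq = begin
      volumeOf (drop (length ps ∸ W) ps)           ≡⟨ volumeOf-reverse (drop (length ps ∸ W) ps) ⟨
      volumeOf (reverse (drop (length ps ∸ W) ps)) ≡⟨ cong volumeOf (take-reverse W ps) ⟨
      volumeOf (take W (reverse ps))               ≡⟨ cong (volumeOf ∘ take W) eq ⟨
      volumeOf (take W (map packet h))             ≡⟨ cong volumeOf (take-map W h) ⟩
      volume W h                                   ∎
      where open ≡-Reasoning

  -- Runs of WFAST follow valid histories

  module WFASTAnalysis {a ℓ₁ ℓ₂ u} (F : FloorField a ℓ₁ ℓ₂) {U : Set u} (_≟_ : DecidableEquality U)
               (W M : ℕ) .{{_ : NonZero W}} .{{_ : NonZero M}}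
               (ε φ : FloorField.Carrier F)
               (0<ε : FloorField._<_ F (FloorField.0# F) ε)
               (0≤φ : FloorField._≤_ F (FloorField.0# F) φ)
               (k∣W : numBlocks F ε ∣ W) (x : U) where
    open FloorField F using (1#; fromℕ) renaming (_/_ to _÷_)
    open FloorFieldProperties F
    open WFAST F _≟_ W M ε φ 0<ε 0≤φ k∣W
    open State
    open Packet

    β : ℕ
    β = blockSize

    abstract
      W≡k*β : W ≡ k * β
      W≡k*β = sym (trans (*-comm k β) (m/n*n≡m k∣W))

      T≡β*M : T ≡ β * M
      T≡β*M = trans (*-/-assoc M k∣W) (*-comm M β)

      capacity : k * (M + 2 * (Y.s ∸ 1)) ≤ M * Y.ℭ
      capacity = FAST-capacity F _≟_ M k φ 0≤φ

    module Y′ = FASTAnalysis F _≟_ M (1# ÷ fromℕ k) φ (1/-pos (fromℕ-pos k)) 0≤φ k capacity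
    open History _≟_ M x
    open Queue β
    open Frames _≟_ x W M k β T W≡k*β T≡β*M

    incr-tableEntry : ∀ n → incr (tableEntry n) ≡ tableEntry (suc n)
    incr-tableEntry zero    = refl
    incr-tableEntry (suc _) = refl

    decr-tableEntry : ∀ n → decr (tableEntry (suc n)) ≡ tableEntry n
    decr-tableEntry zero    = refl
    decr-tableEntry (suc _) = refl

    Invariant : List Event → State → Set u
    Invariant h S = Consistent h (Y.query (y S) x) (o S) (b S) (B S x) × Y′.Invariant (suc (offset h)) (y S)

    initial-invariant : Invariant [] initial
    initial-invariant = record
      { valid   = []
      ; queried = Y′.query-initial x
      ; o≡      = refl
      ; fits    = fits-replicate _ _ (suc k)
      ; entry≡  = sym (cong tableEntry (queued-replicate (suc k)))
      -- The index is `suc (offset [])`, one more than the number of packets seen; the invariant of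
      -- FAST only asks for an upper bound.
      } , Y′.initial-invariant 1

    expire-[] : ∀ (b : Queues) B → Vec.last b ≡ [] → expire b B ≡ (b , B)
    expire-[] b B eq rewrite eq = refl

    expire-∷ : ∀ (b : Queues) B {z zs} → Vec.last b ≡ z ∷ zs → expire b B ≡ (Vec.init b Vec.∷ʳ zs , B [ z ↦ decr (B z) ])
    expire-∷ b B eq rewrite eq = refl

    expire-fits : ∀ {l e} (b : Queues) B h → Fits l e b h → Fits l (suc e) (proj₁ (expire b B)) h
    expire-fits {l} {e} b B h f = by-last (Vec.last b) refl
      where
      f′ : ∀ {zs} → Vec.last b ≡ zs → Fits l (suc e) (Vec.init b Vec.∷ʳ drop 1 zs) h
      f′ eq = subst (λ zs → Fits l (suc e) (Vec.init b Vec.∷ʳ drop 1 zs) h) eq (fits-pop {l} {e} b h f)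
      by-last : ∀ zs → Vec.last b ≡ zs → Fits l (suc e) (proj₁ (expire b B)) h
      by-last []       eq = subst (λ b → Fits l (suc e) b h)
        (sym (trans (cong proj₁ (expire-[] b B eq)) (trans (proj₂ (proj₂ (Vec.initLast b))) (cong (Vec.init b Vec.∷ʳ_) eq)))) (f′ eq)
      by-last (z ∷ zs) eq = subst (λ b → Fits l (suc e) b h) (sym (cong proj₁ (expire-∷ b B eq))) (f′ eq)

    -- If `x` is popped, it was itself counted, so the decreased entry is that of a positive number
    -- and the default cases of `decr` do not arise.
    decr-entry : ∀ z zs n B → B x ≡ tableEntry (n + occurrences (z ∷ zs)) →
                 (B [ z ↦ decr (B z) ]) x ≡ tableEntry (n + occurrences zs)
    decr-entry z zs n B eq = by-ident (x ≟ z)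
      where
      open ≡-Reasoning
      by-ident : Dec (x ≡ z) → (B [ z ↦ decr (B z) ]) x ≡ tableEntry (n + occurrences zs)
      by-ident (yes refl) = begin
        (B [ x ↦ decr (B x) ]) x                     ≡⟨ if-yes (x ≟ x) refl ⟩
        decr (B x)                                   ≡⟨ cong decr eq ⟩
        decr (tableEntry (n + occurrences (x ∷ zs))) ≡⟨ cong (λ ys → decr (tableEntry (n + length ys))) (filter-accept (_≟ x) refl) ⟩
        decr (tableEntry (n + suc (occurrences zs))) ≡⟨ cong (decr ∘ tableEntry) (+-suc n (occurrences zs)) ⟩
        decr (tableEntry (suc (n + occurrences zs))) ≡⟨ decr-tableEntry (n + occurrences zs) ⟩
        tableEntry (n + occurrences zs)              ∎
      by-ident (no x≢z) = begin
        (B [ z ↦ decr (B z) ]) x                     ≡⟨ if-no (x ≟ z) x≢z ⟩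
        B x                                          ≡⟨ eq ⟩
        tableEntry (n + occurrences (z ∷ zs))        ≡⟨ cong (λ ys → tableEntry (n + length ys)) (filter-reject (_≟ x) (x≢z ∘ sym)) ⟩
        tableEntry (n + occurrences zs)              ∎

    expire-entry : ∀ (b : Queues) B → B x ≡ tableEntry (queued b) →
                   proj₂ (expire b B) x ≡ tableEntry (queued (proj₁ (expire b B)))
    expire-entry b B eq = by-last (Vec.last b) refl
      where
      Entry : Queues × Table → Set
      Entry (b , B) = B x ≡ tableEntry (queued b)
      by-last : ∀ zs → Vec.last b ≡ zs → Entry (expire b B)
      by-last []       last≡ = subst Entry (sym (expire-[] b B last≡)) eq
      by-last (z ∷ zs) last≡ = subst Entry (sym (expire-∷ b B last≡))
        (trans (decr-entry z zs (queued (Vec.init b)) B (trans eq (cong tableEntry (trans (queued-init b) (cong (λ zs → queued (Vec.init b) + occurrences zs) last≡)))))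
               (cong tableEntry (sym (queued-∷ʳ (Vec.init b) zs))))

    newBlock-invariant : ∀ {h} (b : Queues) → Fits (suc (blockOffset h)) (suc (blockOffset h)) b h →
      let o′ = nextOffset (offset h) ; t′ = o′ % blockSize in
      Fits t′ t′ (newBlock o′ b) h × queued (newBlock o′ b) ≡ queued b
    newBlock-invariant {h} b f = by-next (nextBlock h)
      where
      o′ t′ : ℕ
      o′ = nextOffset (offset h)
      t′ = o′ % blockSize
      by-next : Next β (blockOffset h) → Fits t′ t′ (newBlock o′ b) h × queued (newBlock o′ b) ≡ queued b
      by-next (inside _ eq) = subst₂ (λ i b → Fits i i b h) (sym t′≡) (sym b≡) f , cong queued b≡
        where
        t′≡ : t′ ≡ suc (blockOffset h)
        t′≡ = trans (blockOffset-step h) eq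
        b≡ : newBlock o′ b ≡ b
        b≡ = if-no (t′ ℕₚ.≟ 0) (λ t′≡0 → 0≢1+n (trans (sym t′≡0) t′≡))
      by-next (wraps ≡β eq) = subst₂ (λ i b → Fits i i b h) (sym t′≡) (sym b≡) (fits-newBlock b h f′) , trans (cong queued b≡) queued≡
        where
        t′≡ : t′ ≡ 0
        t′≡ = trans (blockOffset-step h) eq
        b≡ : newBlock o′ b ≡ [] ∷ Vec.init b
        b≡ = if-yes (t′ ℕₚ.≟ 0) t′≡
        f′ : Fits β β b h
        f′ = subst (λ i → Fits i i b h) ≡β f
        queued≡ : queued (Vec.init b) ≡ queued b
        queued≡ = sym (trans (queued-init b)
          (trans (cong (λ z → queued (Vec.init b) + occurrences z) (fits-last b h f′)) (+-identityʳ _)))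

    newFrame-invariant : ∀ {h y} → Y′.Invariant (suc (offset h)) y → Y.query y x ≡ current h →
      let o′ = nextOffset (offset h) in
      Y′.Invariant o′ (newFrame o′ y) × Y.query (newFrame o′ y) x ≡ before h
    newFrame-invariant {h} {y} I q≡ = by-next (next (offset<W h))
      where
      o′ : ℕ
      o′ = nextOffset (offset h)
      by-next : Next W (offset h) → Y′.Invariant o′ (newFrame o′ y) × Y.query (newFrame o′ y) x ≡ before h
      by-next (inside _ eq) = subst₂ Y′.Invariant (sym eq) (sym y≡) I
          , trans (cong (λ y → Y.query y x) y≡) (trans q≡ (sym (before-inside {h} eq)))
        where
        y≡ : newFrame o′ y ≡ y
        y≡ = if-no (o′ ℕₚ.≟ 0) (λ o′≡0 → 0≢1+n (trans (sym o′≡0) eq))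
      by-next (wraps _ eq) = subst₂ Y′.Invariant (sym eq) (sym y≡) (Y′.initial-invariant 0)
          , trans (cong (λ y → Y.query y x) y≡) (trans (Y′.query-initial x) (sym (before-wraps {h} eq)))
        where
        y≡ : newFrame o′ y ≡ Y.initial
        y≡ = if-yes (o′ ℕₚ.≟ 0) eq

    event : Packet U M → Y.State → Y.State → Event
    event p y₁ y₂ = record
      { packet     = p
      ; overflowed = crosses (Y.query y₁ (ident p)) (Y.query y₂ (ident p))
      ; estimate   = Y.query y₂ x
      }

    event-step : ∀ {h p y₁ y₂} → Y′.Invariant (nextOffset (offset h)) y₁ → Y.query y₁ x ≡ before h →
                 Y.Add y₁ (ident p) (weight p) y₂ → Step h (event p y₁ y₂)
    event-step {h} {p} {y₁} {y₂} I q≡ A = by-ident (ident p ≟ x)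
      where
      by-ident : Dec (ident p ≡ x) → Step h (event p y₁ y₂)
      by-ident (yes refl) = hit refl (trans (Y′.add-query-self A) (cong (_+ weight p) q≡))
        (cong (λ q → crosses q (Y.query y₂ x)) q≡)
      by-ident (no i≢x) = miss i≢x (Sum.map (λ eq → trans eq q≡) (λ (≤q , small) → subst (_≤ Y.query y₂ x) q≡ ≤q , small)
        (Y′.add-query-other (weight≤M p) I A (i≢x ∘ sym)))

    overflow-entry : ∀ i (b : Queues) B → B x ≡ tableEntry (queued b) →
                     (B [ i ↦ incr (B i) ]) x ≡ tableEntry (queued ((Vec.head b ∷ʳ i) ∷ Vec.tail b))
    overflow-entry i (z ∷ b) B eq = by-ident (x ≟ i)
      where
      open ≡-Reasoning
      by-ident : Dec (x ≡ i) → (B [ i ↦ incr (B i) ]) x ≡ tableEntry (queued ((z ∷ʳ i) ∷ b))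
      by-ident (yes refl) = begin
        (B [ x ↦ incr (B x) ]) x                  ≡⟨ if-yes (x ≟ x) refl ⟩
        incr (B x)                                ≡⟨ cong incr eq ⟩
        incr (tableEntry (occurrences z + queued b)) ≡⟨ incr-tableEntry _ ⟩
        tableEntry (suc (occurrences z) + queued b) ≡⟨ cong (λ n → tableEntry (n + queued b)) (+-comm 1 (occurrences z)) ⟩
        tableEntry (occurrences z + 1 + queued b) ≡⟨ cong (λ ys → tableEntry (occurrences z + length ys + queued b)) (filter-accept (_≟ x) refl) ⟨
        tableEntry (occurrences z + occurrences [ x ] + queued b) ≡⟨ cong (λ n → tableEntry (n + queued b)) (occurrences-++ z [ x ]) ⟨
        tableEntry (occurrences (z ∷ʳ x) + queued b) ∎
      by-ident (no x≢i) = begin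
        (B [ i ↦ incr (B i) ]) x                  ≡⟨ if-no (x ≟ i) x≢i ⟩
        B x                                       ≡⟨ eq ⟩
        tableEntry (occurrences z + queued b)     ≡⟨ cong (λ n → tableEntry (n + queued b)) (+-identityʳ (occurrences z)) ⟨
        tableEntry (occurrences z + 0 + queued b) ≡⟨ cong (λ ys → tableEntry (occurrences z + length ys + queued b)) (filter-reject (_≟ x) (x≢i ∘ sym)) ⟨
        tableEntry (occurrences z + occurrences [ i ] + queued b) ≡⟨ cong (λ n → tableEntry (n + queued b)) (occurrences-++ z [ i ]) ⟨
        tableEntry (occurrences (z ∷ʳ i) + queued b) ∎

    -- The test made by `update` is abstracted as `c` to handle both of its branches. On entry the
    -- pop of this addition is done but its packet is not yet recorded, so the pop count is one
    -- ahead; afterwards both counts agree again.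
    record-event : ∀ c {v h S} → overflowed v ≡ c → Valid (v ∷ h) → Y.query (y S) x ≡ estimate v →
      o S ≡ offset (v ∷ h) → Fits (blockOffset (v ∷ h)) (suc (blockOffset (v ∷ h))) (b S) h →
      B S x ≡ tableEntry (queued (b S)) →
      let S′ = if c then overflow (ident (packet v)) S else S in
      Consistent (v ∷ h) (Y.query (y S′) x) (o S′) (b S′) (B S′ x)
    record-event c {v} {h} {S} ov val q≡ o≡ f entry≡ = by-overflow c ov
      where
      l : ℕ
      l = blockOffset (v ∷ h)
      i : U
      i = ident (packet v)
      pushed : ∀ {c} → overflowed v ≡ c →
               Fits (suc l) (suc l) ((Vec.head (b S) ++ (if c then [ i ] else [])) ∷ Vec.tail (b S)) (v ∷ h)
      pushed ov = subst (λ c → Fits (suc l) (suc l) ((Vec.head (b S) ++ (if c then [ i ] else [])) ∷ Vec.tail (b S)) (v ∷ h))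
        ov (fits-push (b S) v h f)
      head-++-[] : ∀ (b : Queues) → (Vec.head b ++ []) ∷ Vec.tail b ≡ b
      head-++-[] (z ∷ b) = cong (_∷ b) (++-identityʳ z)
      by-overflow : ∀ c → overflowed v ≡ c → let S′ = if c then overflow i S else S in
                    Consistent (v ∷ h) (Y.query (y S′) x) (o S′) (b S′) (B S′ x)
      by-overflow true ov = record
        { valid = val ; queried = q≡ ; o≡ = o≡ ; fits = pushed ov ; entry≡ = overflow-entry i (b S) (B S) entry≡ }
      by-overflow false ov = record
        { valid = val ; queried = q≡ ; o≡ = o≡ ; entry≡ = entry≡
        ; fits = subst (λ b → Fits (suc l) (suc l) b (v ∷ h)) (head-++-[] (b S)) (pushed ov) }

    y-if : ∀ c i S → y (if c then overflow i S else S) ≡ y S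
    y-if true  i S = refl
    y-if false i S = refl

    add-invariant : ∀ {h S p S′} → Invariant h S → Add S (ident p) (weight p) S′ →
                    ∃ λ v → packet v ≡ p × Invariant (v ∷ h) S′
    add-invariant {h} {S} {p} (I , fast) (add {y′} A) = go (o S) (Consistent.o≡ I) A
      where
      open Consistent I using (valid; queried; fits; entry≡)
      -- The type of `A` mentions the stored offset, which must be a variable before it can be
      -- identified with `offset h`.
      go : ∀ o₀ → o₀ ≡ offset h → let S₁ = prepare (record S { o = o₀ }) in Y.Add (y S₁) (ident p) (weight p) y′ →
           ∃ λ v → packet v ≡ p × Invariant (v ∷ h) (update S₁ (ident p) y′)
      go _ refl A = v , refl
        , record-event (overflowed v) {v} {h} {S₂} refl (event-step fast₁ query₁ A ∷ valid) refl refl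
            (expire-fits _ (B S) h fits₁) (expire-entry _ (B S) (trans entry≡ (cong tableEntry (sym queued₁))))
        , subst (Y′.Invariant _) (sym (y-if (overflowed v) (ident p) S₂)) (Y′.add-invariant (weight≤M p) fast₁ A)
        where
        o₁ : ℕ
        o₁ = nextOffset (offset h)
        S₁ S₂ : State
        S₁ = prepare (record S { o = offset h })
        S₂ = record S₁ { y = y′ }
        v : Event
        v = event p (y S₁) y′
        fast₁ : Y′.Invariant o₁ (y S₁)
        fast₁ = proj₁ (newFrame-invariant {h} fast queried)
        query₁ : Y.query (y S₁) x ≡ before h
        query₁ = proj₂ (newFrame-invariant {h} fast queried)
        fits₁ : Fits (o₁ % blockSize) (o₁ % blockSize) (newBlock o₁ (b S)) h
        fits₁ = proj₁ (newBlock-invariant {h} (b S) fits)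
        queued₁ : queued (newBlock o₁ (b S)) ≡ queued (b S)
        queued₁ = proj₂ (newBlock-invariant {h} (b S) fits)

    process-invariant : ∀ {h S ps S′} → Invariant h S → Process S ps S′ →
                        ∃ λ h′ → map packet h′ ≡ ps ʳ++ map packet h × Invariant h′ S′
    process-invariant {h} I []      = h , refl , I
    process-invariant {h} I (_∷_ {p} {ps} a as) =
      let v , v≡p , I₁  = add-invariant {h} {p = p} I a
          h′ , h′≡ , I′ = process-invariant I₁ as
      in  h′ , trans h′≡ (cong (λ p → ps ʳ++ (p ∷ map packet h)) v≡p) , I′

    winQuery-estimated : ∀ S n → B S x ≡ tableEntry n → winQuery S x ≡ estimated n (Y.query (y S) x)
    winQuery-estimated S zero    eq rewrite eq = refl
    winQuery-estimated S (suc n) eq rewrite eq = refl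

    invariant-bounds : ∀ {h S} → Invariant h S → volume W h ≤ winQuery S x × winQuery S x ≤ volume W h + 4 * T
    invariant-bounds {h} {S} (I , _) = subst (λ q → volume W h ≤ q × q ≤ volume W h + 4 * T)
        (sym (trans (winQuery-estimated S n entry≡) (cong (estimated n) queried)))
        (estimated-bounds valid n L L+β≡
          (≤-queued l≤β (b S) h fits L (trans L+β≡ (cong (_+ l) W≡k*β)))
          (queued-≤ l≤β (b S) h fits W (cong (_+ l) W≡k*β)))
      where
      open Consistent I
      n l L : ℕ
      n = queued (b S)
      l = suc (blockOffset h)
      -- The `k + 1` queues span `k * β + l = W + l` packets. Without the oldest block `L` of them
      -- remain; without only its `l` oldest packets, whose entries the `l` pops have removed,
      -- exactly `W` remain.
      L = W + l ∸ β
      l≤β : l ≤ β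
      l≤β = blockOffset<β h
      L+β≡ : L + β ≡ W + l
      L+β≡ = m∸n+n≡m (≤-trans (m/n≤m W k) (m≤m+n W l))

    winQuery-bounds : ∀ {ps S} → Process initial ps S →
                      windowVolume _≟_ W ps x ≤ winQuery S x ×
                      winQuery S x ≤ windowVolume _≟_ W ps x + 4 * T
    winQuery-bounds {ps} {S} run =
      let h , h≡ , I = process-invariant {[]} initial-invariant run
      in  subst (λ v → v ≤ winQuery S x × winQuery S x ≤ v + 4 * T)
            (sym (windowVolume-history _≟_ x W ps h h≡)) (invariant-bounds {h} {S} I)

theorem4 : ∀ {a ℓ₁ ℓ₂ u : Level} (F : FloorField a ℓ₁ ℓ₂) → let open FloorField F in
    {U : Set u} (_≟_ : DecidableEquality U)
    (W M : ℕ) .{{_ : NonZero W}} .{{_ : NonZero M}}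
    (ε φ : Carrier) (0<ε : 0# < ε) (0≤φ : 0# ≤ φ) (k∣W : numBlocks F ε ∣ W) →
    let open WFAST F _≟_ W M ε φ 0<ε 0≤φ k∣W in
    (ps : Stream U M) (S : State) → Process initial ps S →
    (x : U) →
    (fromℕ (windowVolume _≟_ W ps x) ≤ fromℕ (winQuery S x))
    × (fromℕ (winQuery S x) ≤ fromℕ (windowVolume _≟_ W ps x) + fromℕ W * fromℕ M * ε)
theorem4 F _≟_ W M ε φ 0<ε 0≤φ k∣W ps S run x =
  fromℕ-mono-≤ (proj₁ bounds) , (begin
    fromℕ (winQuery S x)                    ≤⟨ fromℕ-mono-≤ (proj₂ bounds) ⟩
    fromℕ (v ℕ.+ 4 ℕ.* T)                   ≈⟨ fromℕ-+ v (4 ℕ.* T) ⟩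
    fromℕ v + fromℕ (4 ℕ.* T)               ≤⟨ +-monoʳ-≤ (fromℕ v) (4*T≤W*M*ε W M T 0<ε Tk≡WM) ⟩
    fromℕ v + fromℕ W * fromℕ M * ε         ∎)
  where
  open FloorField F
  open OrderedFieldProperties F
  open WFAST F _≟_ W M ε φ 0<ε 0≤φ k∣W using (winQuery; T; k; k-nonZero)
  open Analysis.WFASTAnalysis F _≟_ W M ε φ 0<ε 0≤φ k∣W x using (winQuery-bounds)
  open import Relation.Binary.Reasoning.PartialOrder poset
  v : ℕ
  v = windowVolume _≟_ W ps x
  bounds : v ℕ.≤ winQuery S x × winQuery S x ℕ.≤ v ℕ.+ 4 ℕ.* T
  bounds = winQuery-bounds run
  Tk≡WM : T ℕ.* k ≡.≡ W ℕ.* M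
  Tk≡WM = ≡.trans (m/n*n≡m (∣n⇒∣m*n M k∣W)) (ℕₚ.*-comm M W)
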